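{- As $n\to\infty$, $(1+o(1))\dfrac{n}{2} \le g_{\mathrm{ECB}}(n,K_3) \le (1+o(1))\dfrac{2n}{3}$.
   Context: The embedded Constructor-Blocker game on $n$ vertices: the vertices of $K_n$ are placed at the $n$-th roots of unity in the complex plane and each edge is drawn as the straight chord between its endpoints inside the unit disk. Constructor and Blocker alternately claim previously unclaimed edges, Constructor moving first. Constructor may only claim an edge that does not cross (in an interior point) any edge she has already claimed; Blocker may claim any unclaimed edge. The game ends when Constructor cannot claim any more edges or all edges are claimed. The score is the number of triangles in Constructor's final graph; Constructor maximizes it, Blocker minimizes it, and $g_{\mathrm{ECB}}(n,K_3)$ denotes the score under optimal play by both players. -}

module Defs where

open import Data.Nat using (ℕ; zero; suc; _+_; _*_; _<ᵇ_; _≡ᵇ_; _⊔_; _⊓_)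
open import Data.Bool using (Bool; true; false; _∧_; _∨_; not; if_then_else_)
open import Data.Product using (_×_; _,_)
open import Data.List using (List; []; _∷_; map; concatMap; length; upTo; foldr)
open import Data.Bool.ListAction using (any)
open import Relation.Binary.PropositionalEquality using (_≡_)

bfilter : {A : Set} → (A → Bool) → List A → List A
bfilter p []       = []
bfilter p (x ∷ xs) = if p x then x ∷ bfilter p xs else bfilter p xs

-- Vertices of K_n are 0,1,…,n-1, listed in the cyclic (counterclockwise) order of
-- the n-th roots of unity ω^0,…,ω^(n-1).  An edge is a pair (i , j) with i < j < n.
Edge : Set
Edge = ℕ × ℕ

edges : ℕ → List Edge
edges n = concatMap (λ j → map (λ i → (i , j)) (upTo j)) (upTo n)

edge-eq : Edge → Edge → Bool
edge-eq (a , b) (c , d) = (a ≡ᵇ c) ∧ (b ≡ᵇ d)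

_∈ᵇ_ : Edge → List Edge → Bool
e ∈ᵇ es = any (edge-eq e) es

-- Two straight chords between points in convex position on the unit circle cross
-- in an interior point iff their endpoints strictly interleave in the cyclic order.
-- For edges (a,b), (c,d) with a<b, c<d this is  a<c<b<d  or  c<a<d<b.
crosses : Edge → Edge → Bool
crosses (a , b) (c , d) =
  ((a <ᵇ c) ∧ (c <ᵇ b) ∧ (b <ᵇ d)) ∨ ((c <ᵇ a) ∧ (a <ᵇ d) ∧ (d <ᵇ b))

-- Game state: Constructor's claimed edges C and Blocker's claimed edges B.
unclaimed : ℕ → List Edge → List Edge → List Edge
unclaimed n C B = bfilter (λ e → not (e ∈ᵇ C ∨ e ∈ᵇ B)) (edges n)

constructorMoves : ℕ → List Edge → List Edge → List Edge
constructorMoves n C B =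
  bfilter (λ e → not (any (crosses e) C)) (unclaimed n C B)

triangles : ℕ → List Edge → ℕ
triangles n C =
  length (bfilter isTri triples)
  where
  triples : List (ℕ × ℕ × ℕ)
  triples = concatMap (λ k → concatMap (λ j → map (λ i → (i , j , k)) (upTo j)) (upTo k)) (upTo n)
  isTri : ℕ × ℕ × ℕ → Bool
  isTri (i , j , k) = ((i , j) ∈ᵇ C) ∧ ((j , k) ∈ᵇ C) ∧ ((i , k) ∈ᵇ C)

maxList : List ℕ → ℕ
maxList = foldr _⊔_ 0

-- minimum of a list (only applied to nonempty lists)
minList : List ℕ → ℕ
minList []       = 0
minList (x ∷ xs) = foldr _⊓_ x xs

-- Minimax value of the game from state (C , B), with the Boolean saying whether it
-- is Constructor's turn.  The fuel bounds the number of remaining moves; every move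
-- claims one unclaimed edge, so fuel = number of edges of K_n suffices (when the fuel
-- reaches 0 all edges are claimed).  The game ends (score = triangles in C) as soon
-- as Constructor has no legal move.
value : ℕ → ℕ → Bool → List Edge → List Edge → ℕ
value n zero    _     C B = triangles n C
value n (suc f) true  C B with constructorMoves n C B
... | []       = triangles n C
... | m ∷ ms   = maxList (map (λ e → value n f false (e ∷ C) B) (m ∷ ms))
value n (suc f) false C B with constructorMoves n C B
... | []       = triangles n C
... | _ ∷ _    = minList (map (λ e → value n f true C (e ∷ B)) (unclaimed n C B))

gECB : ℕ → ℕ
gECB n = value n (length (edges n)) true [] []

{-# OPTIONS --safe #-}
module Submission where

-- Upper bound.  Sending a triangle of a non-crossing graph to its middle vertex is injective, and if the
-- boundary edge p(p+1) is missing, then p and p+1 are not both middle vertices.  So s missing boundary edges,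
-- pairwise non-adjacent, leave at most n − s triangles.  Blocker sweeps the boundary and always claims the
-- first available edge; this makes only the next edge useless to him, and Constructor takes at most one in
-- between, so he gets about n/3 of them.
--
-- Lower bound.  Constructor first builds a path through increasing vertices, skipping every vertex that is the
-- larger end of an edge of Blocker (a B-edge).  As no path vertex lies below an edge of hers, all chords of the
-- path stay playable.  Claiming the ear uw of three consecutive path vertices u, v, w gives a triangle and takes
-- v, with all its B-edges, off the path.  A vertex of the path counts 2, a vertex still to come 1 and a B-edge
-- inside the path −1, so that each move of Blocker costs at most 1; Constructor always finds a move that wins it
-- back.  If some inner vertex has a B-edge and some ear is free, she can cut a vertex having a B-edge.  If the
-- first ears are all blocked, she jumps over two or three path vertices carrying many B-edges; when only the ears
-- are blocked there, the jump over three vertices leaves a pentagon in which two crossing diagonals are free and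
-- each completes a triangle, and this reserved pair is worth 2.  The count starts at about n and ends at twice
-- the number of triangles, up to a constant.

open import Defs
open import Data.Bool using (Bool; true; false; _∧_; _∨_; not; T)
open import Data.Bool.ListAction using (any)
open import Data.Bool.Properties using (∨-comm; ∨-zeroʳ)
open import Data.List using (List; []; _∷_; _++_; map; concatMap; length; upTo; applyUpTo; foldr; filter)
open import Data.List.Properties
  using (length-++; length-map; length-upTo; length-applyUpTo; length-filter; upTo-∷ʳ; concatMap-++; ++-assoc;
         ++-identityʳ; filter-accept; filter-reject; filter-all)
open import Data.List.Membership.Propositional using (_∈_; _∉_; lose; find)
open import Data.List.Membership.Propositional.Properties
open import Data.List.Membership.DecPropositional using () renaming (_∈?_ to mem?)
open import Data.List.Relation.Unary.All as All using (All; []; _∷_)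
import Data.List.Relation.Unary.All.Properties as All
open import Data.List.Relation.Unary.AllPairs as AllPairs using (AllPairs; []; _∷_)
import Data.List.Relation.Unary.AllPairs.Properties as AllPairs
open import Data.List.Relation.Unary.Any as Any using (here; there)
open import Data.List.Relation.Unary.Linked as Linked using (Linked; []; [-]; _∷_)
open import Data.List.Relation.Unary.Unique.Propositional using (Unique)
import Data.List.Relation.Unary.Unique.Propositional.Properties as Unique
open import Data.Nat
open import Data.Nat.Properties
open import Data.Nat.Tactic.RingSolver using (solve-∀)
open import Data.Product using (Σ; Σ-syntax; ∃; _×_; _,_; proj₁; proj₂)
open import Data.Product.Properties using (≡-dec)
open import Data.Sum using (_⊎_; inj₁; inj₂; [_,_]′)
open import Data.Unit using (tt)
open import Function using (_∘_; id; case_of_)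
open import Relation.Binary.Definitions using (tri<; tri≈; tri>)
open import Relation.Binary.PropositionalEquality
open import Relation.Nullary using (¬_; Dec; yes; no; contradiction; ¬?)
open import Relation.Nullary.Decidable using (_⊎-dec_)

-- Boolean filters and their reflection.

module _ {A : Set} (p : A → Bool) where

  ∈-bfilter⁺ : ∀ {x xs} → x ∈ xs → p x ≡ true → x ∈ bfilter p xs
  ∈-bfilter⁺ {xs = y ∷ _} (here refl) px rewrite px = here refl
  ∈-bfilter⁺ {xs = y ∷ _} (there x∈) px with p y
  ... | true  = there (∈-bfilter⁺ x∈ px)
  ... | false = ∈-bfilter⁺ x∈ px

  ∈-bfilter⁻ : ∀ {x} xs → x ∈ bfilter p xs → x ∈ xs × p x ≡ true
  ∈-bfilter⁻ (y ∷ xs) x∈ with p y in py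
  ∈-bfilter⁻ (y ∷ xs) (here refl) | true = here refl , py
  ∈-bfilter⁻ (y ∷ xs) (there x∈)  | true with ∈-bfilter⁻ xs x∈
  ... | x∈xs , px = there x∈xs , px
  ∈-bfilter⁻ (y ∷ xs) x∈ | false with ∈-bfilter⁻ xs x∈
  ... | x∈xs , px = there x∈xs , px

  any-true⁻ : ∀ xs → any p xs ≡ true → Σ[ x ∈ A ] x ∈ xs × p x ≡ true
  any-true⁻ (x ∷ xs) eq with p x in px
  ... | true = x , here refl , px
  ... | false with any-true⁻ xs eq
  ...   | y , y∈ , py = y , there y∈ , py

  any-true⁺ : ∀ {x xs} → x ∈ xs → p x ≡ true → any p xs ≡ true
  any-true⁺ (here refl) px rewrite px = refl
  any-true⁺ {xs = y ∷ _} (there x∈) px with p y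
  ... | true  = refl
  ... | false = any-true⁺ x∈ px

module _ {A : Set} {p q : A → Bool} (p⇒q : ∀ x → p x ≡ true → q x ≡ true) where

  length-bfilter-mono : ∀ xs → length (bfilter p xs) ≤ length (bfilter q xs)
  length-bfilter-mono [] = z≤n
  length-bfilter-mono (x ∷ xs) with p x in px | q x in qx
  ... | true  | true  = s≤s (length-bfilter-mono xs)
  ... | true  | false = contradiction (trans (sym qx) (p⇒q x px)) (λ ())
  ... | false | true  = m≤n⇒m≤1+n (length-bfilter-mono xs)
  ... | false | false = length-bfilter-mono xs

  length-bfilter-strict : ∀ {x xs} → x ∈ xs → p x ≡ false → q x ≡ true →
                          length (bfilter p xs) < length (bfilter q xs)
  length-bfilter-strict {xs = _ ∷ xs} (here refl) px qx rewrite px | qx = s≤s (length-bfilter-mono xs)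
  length-bfilter-strict {xs = y ∷ xs} (there x∈) px qx with p y in py | q y in qy
  ... | true  | true  = s≤s (length-bfilter-strict x∈ px qx)
  ... | true  | false = contradiction (trans (sym qy) (p⇒q y py)) (λ ())
  ... | false | true  = m≤n⇒m≤1+n (length-bfilter-strict x∈ px qx)
  ... | false | false = length-bfilter-strict x∈ px qx

T⇒≡true : ∀ {b} → T b → b ≡ true
T⇒≡true {true} _ = refl

≡true⇒T : ∀ {b} → b ≡ true → T b
≡true⇒T refl = tt

≢true⇒≡false : ∀ {b} → b ≢ true → b ≡ false
≢true⇒≡false {true}  b≢ = contradiction refl b≢
≢true⇒≡false {false} _  = refl

≡false⇒≢true : ∀ {b} → b ≡ false → b ≢ true
≡false⇒≢true refl ()

∧-true⁻ : ∀ {a b} → a ∧ b ≡ true → a ≡ true × b ≡ true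
∧-true⁻ {true} eq = refl , eq

∨-true⁻ : ∀ {a b} → a ∨ b ≡ true → a ≡ true ⊎ b ≡ true
∨-true⁻ {true}  eq = inj₁ refl
∨-true⁻ {false} eq = inj₂ eq

∨-false⁻ : ∀ {a b} → a ∨ b ≡ false → a ≡ false × b ≡ false
∨-false⁻ {false} eq = refl , eq

not-true⁻ : ∀ {a} → not a ≡ true → a ≡ false
not-true⁻ {false} _ = refl

<ᵇ-true⁻ : ∀ {m n} → (m <ᵇ n) ≡ true → m < n
<ᵇ-true⁻ {m} {n} eq = <ᵇ⇒< m n (≡true⇒T eq)

<ᵇ-true⁺ : ∀ {m n} → m < n → (m <ᵇ n) ≡ true
<ᵇ-true⁺ m<n = T⇒≡true (<⇒<ᵇ m<n)

-- Edges, crossings and legal moves.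

_≟ᴱ_ : (e h : Edge) → Dec (e ≡ h)
_≟ᴱ_ = ≡-dec _≟_ _≟_

edge-eq-sound : ∀ {e h} → edge-eq e h ≡ true → e ≡ h
edge-eq-sound {a , b} {c , d} eq with ∧-true⁻ {a ≡ᵇ c} eq
... | ac , bd = cong₂ _,_ (≡ᵇ⇒≡ a c (≡true⇒T ac)) (≡ᵇ⇒≡ b d (≡true⇒T bd))

edge-eq-refl : ∀ e → edge-eq e e ≡ true
edge-eq-refl (a , b)
  rewrite T⇒≡true (≡⇒≡ᵇ a a refl) | T⇒≡true (≡⇒≡ᵇ b b refl) = refl

∈ᵇ-sound : ∀ {e} es → e ∈ᵇ es ≡ true → e ∈ es
∈ᵇ-sound es eq with any-true⁻ _ es eq
... | h , h∈ , eqh = subst (_∈ es) (sym (edge-eq-sound eqh)) h∈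

∈ᵇ-complete : ∀ {e es} → e ∈ es → e ∈ᵇ es ≡ true
∈ᵇ-complete {e} e∈ = any-true⁺ (edge-eq e) e∈ (edge-eq-refl e)

∉ᵇ-complete : ∀ {e es} → e ∉ es → e ∈ᵇ es ≡ false
∉ᵇ-complete e∉ = ≢true⇒≡false (e∉ ∘ ∈ᵇ-sound _)

∉ᵇ-sound : ∀ {e es} → e ∈ᵇ es ≡ false → e ∉ es
∉ᵇ-sound eq e∈ = ≡false⇒≢true eq (∈ᵇ-complete e∈)

Cross : Edge → Edge → Set
Cross (a , b) (c , d) = (a < c × c < b × b < d) ⊎ (c < a × a < d × d < b)

Cross-sym : ∀ {e h} → Cross e h → Cross h e
Cross-sym (inj₁ x) = inj₂ x
Cross-sym (inj₂ x) = inj₁ x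

chain-true⁻ : ∀ {a b c d e f} → (a <ᵇ b) ∧ (c <ᵇ d) ∧ (e <ᵇ f) ≡ true → a < b × c < d × e < f
chain-true⁻ {a} {b} {c} {d} eq with ∧-true⁻ {a <ᵇ b} eq
... | ab , eq′ with ∧-true⁻ {c <ᵇ d} eq′
...   | cd , ef = <ᵇ-true⁻ ab , <ᵇ-true⁻ cd , <ᵇ-true⁻ ef

chain-true⁺ : ∀ {a b c d e f} → a < b × c < d × e < f → (a <ᵇ b) ∧ (c <ᵇ d) ∧ (e <ᵇ f) ≡ true
chain-true⁺ (ab , cd , ef) rewrite <ᵇ-true⁺ ab | <ᵇ-true⁺ cd | <ᵇ-true⁺ ef = refl

crosses-sound : ∀ {e h} → crosses e h ≡ true → Cross e h
crosses-sound {a , b} {c , d} eq with ∨-true⁻ {(a <ᵇ c) ∧ (c <ᵇ b) ∧ (b <ᵇ d)} eq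
... | inj₁ x = inj₁ (chain-true⁻ {a} {c} {c} {b} {b} {d} x)
... | inj₂ y = inj₂ (chain-true⁻ {c} {a} {a} {d} {d} {b} y)

crosses-complete : ∀ {e h} → Cross e h → crosses e h ≡ true
crosses-complete {a , b} {c , d} (inj₁ x) rewrite chain-true⁺ x = refl
crosses-complete {a , b} {c , d} (inj₂ y) rewrite chain-true⁺ y =
  ∨-comm ((a <ᵇ c) ∧ (c <ᵇ b) ∧ (b <ᵇ d)) true

record Unclaimed (n : ℕ) (C B : List Edge) (e : Edge) : Set where
  constructor unclaimed-edge
  field
    ordered : proj₁ e < proj₂ e
    bounded : proj₂ e < n
    ∉C      : e ∉ C
    ∉B      : e ∉ B
open Unclaimed

∈-edges⁺ : ∀ {n a b} → a < b → b < n → (a , b) ∈ edges n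
∈-edges⁺ {n} {a} {b} a<b b<n = ∈-concatMap⁺ (λ j → map (λ i → (i , j)) (upTo j))
  (lose (∈-upTo⁺ b<n) (∈-map⁺ (λ i → (i , b)) (∈-upTo⁺ a<b)))

∈-edges⁻ : ∀ {n e} → e ∈ edges n → proj₁ e < proj₂ e × proj₂ e < n
∈-edges⁻ {n} e∈ with find (∈-concatMap⁻ (λ j → map (λ i → (i , j)) (upTo j)) {xs = upTo n} e∈)
... | b , b∈ , e∈′ with ∈-map⁻ (λ i → (i , b)) e∈′
...   | a , a∈ , refl = ∈-upTo⁻ a∈ , ∈-upTo⁻ b∈

unclaimed⁺ : ∀ {n C B e} → Unclaimed n C B e → e ∈ unclaimed n C B
unclaimed⁺ u = ∈-bfilter⁺ _ (∈-edges⁺ (ordered u) (bounded u))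
  (cong not (cong₂ _∨_ (∉ᵇ-complete (∉C u)) (∉ᵇ-complete (∉B u))))

unclaimed⁻ : ∀ {n C B e} → e ∈ unclaimed n C B → Unclaimed n C B e
unclaimed⁻ {n} {C} {B} e∈ with ∈-bfilter⁻ _ (edges n) e∈
... | e∈E , ok with ∈-edges⁻ {n} e∈E | ∨-false⁻ (not-true⁻ ok)
...   | a<b , b<n | ∉C , ∉B = unclaimed-edge a<b b<n (∉ᵇ-sound ∉C) (∉ᵇ-sound ∉B)

record Legal (n : ℕ) (C B : List Edge) (e : Edge) : Set where
  constructor legal
  field
    free     : Unclaimed n C B e
    noncross : ∀ {h} → h ∈ C → ¬ Cross e h
open Legal

constructorMoves⁺ : ∀ {n C B e} → Legal n C B e → e ∈ constructorMoves n C B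
constructorMoves⁺ {C = C} {e = e} l = ∈-bfilter⁺ _ (unclaimed⁺ (free l)) (cong not (≢true⇒≡false λ eq →
  case any-true⁻ (crosses e) C eq of λ where (h , h∈ , cr) → noncross l h∈ (crosses-sound cr)))

constructorMoves⁻ : ∀ {n C B e} → e ∈ constructorMoves n C B → Legal n C B e
constructorMoves⁻ {n} {C} {B} {e} e∈ with ∈-bfilter⁻ _ (unclaimed n C B) e∈
... | e∈U , ok = legal (unclaimed⁻ e∈U) λ h∈ cr →
        ≡false⇒≢true (not-true⁻ ok) (any-true⁺ (crosses e) h∈ (crosses-complete cr))

-- Triangles of Constructor's graph.

Triple : Set
Triple = ℕ × ℕ × ℕ

triples : ℕ → List Triple
triples n = concatMap (λ k → concatMap (λ j → map (λ i → (i , j , k)) (upTo j)) (upTo k)) (upTo n)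

isTriangle : List Edge → Triple → Bool
isTriangle C (i , j , k) = ((i , j) ∈ᵇ C) ∧ ((j , k) ∈ᵇ C) ∧ ((i , k) ∈ᵇ C)

isTriangle⁻ : ∀ {C i j k} → isTriangle C (i , j , k) ≡ true → (i , j) ∈ C × (j , k) ∈ C × (i , k) ∈ C
isTriangle⁻ {C} {i} {j} {k} eq with ∧-true⁻ {(i , j) ∈ᵇ C} eq
... | ij , eq′ with ∧-true⁻ {(j , k) ∈ᵇ C} eq′
...   | jk , ik = ∈ᵇ-sound C ij , ∈ᵇ-sound C jk , ∈ᵇ-sound C ik

isTriangle⁺ : ∀ {C i j k} → (i , j) ∈ C → (j , k) ∈ C → (i , k) ∈ C → isTriangle C (i , j , k) ≡ true
isTriangle⁺ ij jk ik rewrite ∈ᵇ-complete ij | ∈ᵇ-complete jk | ∈ᵇ-complete ik = refl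

isTriangle-mono : ∀ {C} e t → isTriangle C t ≡ true → isTriangle (e ∷ C) t ≡ true
isTriangle-mono {C} e (i , j , k) eq with isTriangle⁻ {C} {i} {j} {k} eq
... | ij , jk , ik = isTriangle⁺ {e ∷ C} (there ij) (there jk) (there ik)

∈-triples⁺ : ∀ {n i j k} → i < j → j < k → k < n → (i , j , k) ∈ triples n
∈-triples⁺ {j = j} {k} i<j j<k k<n =
  ∈-concatMap⁺ (λ k → concatMap (λ j → map (λ i → (i , j , k)) (upTo j)) (upTo k))
    (lose (∈-upTo⁺ k<n) (∈-concatMap⁺ (λ j → map (λ i → (i , j , k)) (upTo j))
      (lose (∈-upTo⁺ j<k) (∈-map⁺ (λ i → (i , j , k)) (∈-upTo⁺ i<j)))))

∈-triples⁻ : ∀ {n i j k} → (i , j , k) ∈ triples n → i < j × j < k × k < n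
∈-triples⁻ {n} t∈ with find (∈-concatMap⁻ (λ k → concatMap (λ j → map (λ i → (i , j , k)) (upTo j)) (upTo k)) {xs = upTo n} t∈)
... | k , k∈ , t∈′ with find (∈-concatMap⁻ (λ j → map (λ i → (i , j , k)) (upTo j)) {xs = upTo k} t∈′)
...   | j , j∈ , t∈″ with ∈-map⁻ (λ i → (i , j , k)) t∈″
...     | i , i∈ , refl = ∈-upTo⁻ i∈ , ∈-upTo⁻ j∈ , ∈-upTo⁻ k∈

triangles-mono : ∀ n e C → triangles n C ≤ triangles n (e ∷ C)
triangles-mono n e C = length-bfilter-mono (isTriangle-mono {C} e) (triples n)

-- All sides are sought in `e ∷ C`, so one constructor serves every position of `e` in the triangle;
-- the last field makes `e` one of the sides, hence the triangle a new one if `e` is new.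
data Completes (n : ℕ) (C : List Edge) (e : Edge) : Set where
  completes : ∀ {i j k} → i < j → j < k → k < n →
              (i , j) ∈ e ∷ C → (j , k) ∈ e ∷ C → (i , k) ∈ e ∷ C →
              e ∈ (i , j) ∷ (j , k) ∷ (i , k) ∷ [] → Completes n C e

triangles-completes : ∀ {n C e} → e ∉ C → Completes n C e → triangles n C < triangles n (e ∷ C)
triangles-completes {n} {C} {e} e∉C (completes {i} {j} {k} i<j j<k k<n ij jk ik e∈) =
  length-bfilter-strict (isTriangle-mono {C} e) (∈-triples⁺ i<j j<k k<n)
    (≢true⇒≡false λ eq → case isTriangle⁻ {C} {i} {j} {k} eq of λ (ij′ , jk′ , ik′) →
       e∉C (All.lookup (ij′ ∷ jk′ ∷ ik′ ∷ []) e∈))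
    (isTriangle⁺ {e ∷ C} ij jk ik)

-- The minimax recursion

module _ {A : Set} (f : A → ℕ) where

  ≤-maxList : ∀ {v x xs} → x ∈ xs → v ≤ f x → v ≤ maxList (map f xs)
  ≤-maxList {xs = y ∷ ys} (here refl) v≤ = ≤-trans v≤ (m≤m⊔n (f y) _)
  ≤-maxList {xs = y ∷ ys} (there x∈)  v≤ = ≤-trans (≤-maxList x∈ v≤) (m≤n⊔m (f y) _)

  maxList-≤ : ∀ {v} xs → (∀ {x} → x ∈ xs → f x ≤ v) → maxList (map f xs) ≤ v
  maxList-≤ []       _ = z≤n
  maxList-≤ (y ∷ ys) h = ⊔-lub (h (here refl)) (maxList-≤ ys (h ∘ there))

  foldr-⊓-≤ : ∀ y {x} xs → x ∈ xs → foldr _⊓_ y (map f xs) ≤ f x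
  foldr-⊓-≤ y (z ∷ xs) (here refl) = m⊓n≤m (f z) _
  foldr-⊓-≤ y (z ∷ xs) (there x∈)  = ≤-trans (m⊓n≤n (f z) _) (foldr-⊓-≤ y xs x∈)

  foldr-⊓-≤-init : ∀ y xs → foldr _⊓_ y (map f xs) ≤ y
  foldr-⊓-≤-init y []       = ≤-refl
  foldr-⊓-≤-init y (z ∷ xs) = ≤-trans (m⊓n≤n (f z) _) (foldr-⊓-≤-init y xs)

  minList-≤ : ∀ {x xs} → x ∈ xs → minList (map f xs) ≤ f x
  minList-≤ {xs = y ∷ ys} (here refl) = foldr-⊓-≤-init (f y) ys
  minList-≤ {xs = y ∷ ys} (there x∈)  = foldr-⊓-≤ (f y) ys x∈

  ≤-foldr-⊓ : ∀ {v} y xs → v ≤ y → (∀ {x} → x ∈ xs → v ≤ f x) → v ≤ foldr _⊓_ y (map f xs)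
  ≤-foldr-⊓ y []       v≤y _ = v≤y
  ≤-foldr-⊓ y (z ∷ xs) v≤y h = ⊓-glb (h (here refl)) (≤-foldr-⊓ y xs v≤y (h ∘ there))

  ≤-minList : ∀ {v x xs} → x ∈ xs → (∀ {y} → y ∈ xs → v ≤ f y) → v ≤ minList (map f xs)
  ≤-minList {xs = y ∷ ys} _ h = ≤-foldr-⊓ (f y) ys (h (here refl)) (h ∘ there)

constructorMoves⊆unclaimed : ∀ {n C B e} → e ∈ constructorMoves n C B → e ∈ unclaimed n C B
constructorMoves⊆unclaimed {n} {C} {B} = proj₁ ∘ ∈-bfilter⁻ _ (unclaimed n C B)

module _ (n f : ℕ) (C B : List Edge) {v : ℕ} where

  constructor-move-≥ : ∀ {e} → Legal n C B e → v ≤ value n f false (e ∷ C) B → v ≤ value n (suc f) true C B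
  constructor-move-≥ l v≤ with constructorMoves n C B | constructorMoves⁺ l
  ... | m ∷ ms | e∈ = ≤-maxList (λ e → value n f false (e ∷ C) B) e∈ v≤

  -- If Constructor has no move left, the value does not depend on whose turn it is.
  blocker-moves-≥ : v ≤ value n (suc f) true C B →
                    (∀ {e} → Unclaimed n C B e → v ≤ value n f true C (e ∷ B)) →
                    v ≤ value n (suc f) false C B
  blocker-moves-≥ stuck h with constructorMoves n C B in eq
  ... | []     = stuck
  ... | m ∷ ms = ≤-minList (λ e → value n f true C (e ∷ B))
                   (constructorMoves⊆unclaimed {n} {C} {B} (subst (m ∈_) (sym eq) (here refl)))
                   (h ∘ unclaimed⁻)

  -- The disjunction settles the branch in which Constructor has no move: either the count is small
  -- already, or a legal move refutes the branch.
  constructor-moves-≤ : (triangles n C ≤ v ⊎ ∃ (Legal n C B)) →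
                        (∀ {e} → Legal n C B e → value n f false (e ∷ C) B ≤ v) →
                        value n (suc f) true C B ≤ v
  constructor-moves-≤ done h with constructorMoves n C B in eq
  constructor-moves-≤ (inj₁ t≤v)     h | [] = t≤v
  constructor-moves-≤ (inj₂ (_ , l)) h | [] = case subst (_ ∈_) eq (constructorMoves⁺ l) of λ ()
  constructor-moves-≤ done           h | m ∷ ms =
    maxList-≤ (λ e → value n f false (e ∷ C) B) (m ∷ ms) (λ e∈ → h (constructorMoves⁻ (subst (_ ∈_) (sym eq) e∈)))

  -- `Legal` is legality for Constructor: such an edge shows that the game is not over, and being
  -- unclaimed it is open to Blocker as well.
  blocker-move-≤ : ∀ {e} → Legal n C B e → value n f true C (e ∷ B) ≤ v → value n (suc f) false C B ≤ v
  blocker-move-≤ {e} l ≤v with constructorMoves n C B | constructorMoves⁺ l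
  ... | m ∷ ms | _ = ≤-trans (minList-≤ (λ e → value n f true C (e ∷ B)) (unclaimed⁺ (free l))) ≤v

-- Triangles once made are never lost, so Constructor may stop following a strategy at any time.
triangles≤value : ∀ n f b C B → triangles n C ≤ value n f b C B
triangles≤value-constructor : ∀ n f C B → triangles n C ≤ value n (suc f) true C B

triangles≤value n zero    b     C B = ≤-refl
triangles≤value n (suc f) true  C B = triangles≤value-constructor n f C B
triangles≤value n (suc f) false C B =
  blocker-moves-≥ n f C B (triangles≤value-constructor n f C B) (λ _ → triangles≤value n f true C _)

triangles≤value-constructor n f C B with constructorMoves n C B
... | []     = ≤-refl
... | m ∷ ms = ≤-maxList (λ e → value n f false (e ∷ C) B) {xs = m ∷ ms} (here refl)
                 (≤-trans (triangles-mono n m C) (triangles≤value n f false (m ∷ C) B))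

-- The number of edges, which is the fuel of the game.

length-edges-suc : ∀ n → length (edges (suc n)) ≡ length (edges n) + n
length-edges-suc n = begin
  length (concatMap column (upTo (suc n)))               ≡⟨ cong (length ∘ concatMap column) (sym (upTo-∷ʳ n)) ⟩
  length (concatMap column (upTo n ++ n ∷ []))           ≡⟨ cong length (concatMap-++ column (upTo n) (n ∷ [])) ⟩
  length (edges n ++ column n ++ [])                     ≡⟨ length-++ (edges n) ⟩
  length (edges n) + length (column n ++ [])             ≡⟨ cong (λ es → length (edges n) + length es) (++-identityʳ (column n)) ⟩
  length (edges n) + length (column n)                   ≡⟨ cong (length (edges n) +_) (length-map (λ i → (i , n)) (upTo n)) ⟩
  length (edges n) + length (upTo n)                     ≡⟨ cong (length (edges n) +_) (length-upTo n) ⟩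
  length (edges n) + n                                   ∎
  where
  open ≡-Reasoning
  column : ℕ → List Edge
  column j = map (λ i → (i , j)) (upTo j)

-- No strategy below asks for more than `4 * n` moves, so the fuel never runs out while one is in
-- progress.
4*n≤length-edges : ∀ {n} → 9 ≤ n → 4 * n ≤ length (edges n)
4*n≤length-edges 9≤n with ≤⇒≤′ 9≤n
... | 9≤′n = go 9≤′n
  where
  open ≤-Reasoning
  go : ∀ {n} → 9 ≤′ n → 4 * n ≤ length (edges n)
  -- Both sides evaluate to 36.
  go ≤′-refl = ≤-refl
  go {suc n} (≤′-step 9≤′n) = begin
    4 * suc n                ≡⟨ *-suc 4 n ⟩
    4 + 4 * n                ≡⟨ +-comm 4 (4 * n) ⟩
    4 * n + 4                ≤⟨ +-mono-≤ (go 9≤′n) (≤-trans (m≤m+n 4 5) (≤′⇒≤ 9≤′n)) ⟩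
    length (edges n) + n     ≡⟨ length-edges-suc n ⟨
    length (edges (suc n))   ∎

-- Blocker's strategy

Unique⇒length-≤ : ∀ {A : Set} {xs ys : List A} → Unique xs → (∀ {x} → x ∈ xs → x ∈ ys) → length xs ≤ length ys
Unique⇒length-≤ []           _   = z≤n
Unique⇒length-≤ {xs = x ∷ xs} (x∉ ∷ xs!) sub with ∈-∃++ (sub (here refl))
... | as , bs , refl = subst (suc (length xs) ≤_) (sym (trans (length-++ as) (+-suc (length as) (length bs))))
        (s≤s (subst (length xs ≤_) (length-++ as) (Unique⇒length-≤ xs! sub′)))
  where
  sub′ : ∀ {y} → y ∈ xs → y ∈ as ++ bs
  sub′ y∈ with ∈-++⁻ as (sub (there y∈))
  ... | inj₁ y∈as         = ∈-++⁺ˡ y∈as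
  ... | inj₂ (here refl)  = contradiction refl (All.lookup x∉ y∈)
  ... | inj₂ (there y∈bs) = ∈-++⁺ʳ as y∈bs

-- `key` recovers the block an element comes from, so different blocks are disjoint.
Unique-concatMap : ∀ {A B : Set} {f : A → List B} (key : B → A) {xs} → Unique xs →
                   (∀ x → Unique (f x)) → (∀ x {y} → y ∈ f x → key y ≡ x) → Unique (concatMap f xs)
Unique-concatMap key xs! f! keyed = Unique.concat⁺ (All.map⁺ (All.universal f! _))
  (AllPairs.map⁺ (AllPairs.map (λ x≢y {_} (z∈x , z∈y) → x≢y (trans (sym (keyed _ z∈x)) (keyed _ z∈y))) xs!))

Unique-map : ∀ {A B : Set} {f : A → B} {xs} → (∀ {x y} → x ∈ xs → y ∈ xs → f x ≡ f y → x ≡ y) →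
             Unique xs → Unique (map f xs)
Unique-map inj []         = []
Unique-map inj (x∉ ∷ xs!) =
  All.map⁺ (All.tabulate λ y∈ eq → All.lookup x∉ y∈ (inj (here refl) (there y∈) eq)) ∷
  Unique-map (λ x∈ y∈ → inj (there x∈) (there y∈)) xs!

Unique-bfilter : ∀ {A : Set} (p : A → Bool) {xs} → Unique xs → Unique (bfilter p xs)
Unique-bfilter p [] = []
Unique-bfilter p {x ∷ xs} (x∉ ∷ xs!) with p x
... | true  = All.tabulate (λ y∈ → All.lookup x∉ (proj₁ (∈-bfilter⁻ p xs y∈))) ∷ Unique-bfilter p xs!
... | false = Unique-bfilter p xs!

triples-Unique : ∀ n → Unique (triples n)
triples-Unique n = Unique-concatMap (λ (i , j , k) → k) (Unique.upTo⁺ n)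
  (λ k → Unique-concatMap (λ (i , j , k) → j) (Unique.upTo⁺ k)
    (λ j → Unique.map⁺ (cong proj₁) (Unique.upTo⁺ j))
    (λ j t∈ → case ∈-map⁻ (λ i → (i , j , k)) t∈ of λ where (_ , _ , refl) → refl))
  (λ k t∈ → case find (∈-concatMap⁻ (λ j → map (λ i → (i , j , k)) (upTo j)) {xs = upTo k} t∈) of λ where
    (j , _ , t∈′) → case ∈-map⁻ (λ i → (i , j , k)) t∈′ of λ where (_ , _ , refl) → refl)

without : ℕ → List ℕ → List ℕ
without x = filter (λ u → ¬? (u ≟ x))

length-without : ∀ x {xs} → AllPairs _<_ xs → length xs ≤ suc (length (without x xs))
length-without x [] = z≤n
length-without x {y ∷ ys} (y< ∷ ys<) with y ≟ x
... | no  y≢x  = subst (λ zs → suc (length ys) ≤ suc (length zs)) (sym (filter-accept (λ u → ¬? (u ≟ x)) y≢x))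
                   (s≤s (length-without x ys<))
... | yes refl = subst (λ zs → suc (length ys) ≤ suc (length zs))
                   (sym (trans (filter-reject (λ u → ¬? (u ≟ x)) (λ x≢x → x≢x refl))
                               (filter-all (λ u → ¬? (u ≟ x)) (All.map (≢-sym ∘ <⇒≢) y<)))) ≤-refl

All-without : ∀ {P : ℕ → Set} x {xs} → All P xs → All (λ y → y ≢ x × P y) (without x xs)
All-without x {xs} pxs = All.zip (All.all-filter (λ u → ¬? (u ≟ x)) xs , All.filter⁺ (λ u → ¬? (u ≟ x)) pxs)

AllPairs-without : ∀ {R : ℕ → ℕ → Set} x {xs} → AllPairs R xs → AllPairs R (without x xs)
AllPairs-without x = AllPairs.filter⁺ (λ u → ¬? (u ≟ x))

without-length : ∀ x xs → length (without x xs) ≤ length xs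
without-length x = length-filter (λ u → ¬? (u ≟ x))

-- Triangles of a non-crossing graph against its missing boundary edges.

NonCrossing : List Edge → Set
NonCrossing C = ∀ {e h} → e ∈ C → h ∈ C → ¬ Cross e h

-- Largest first, in the order reverse to Blocker's sweep. The boundary edges starting at two
-- members share no vertex.
Gapped : List ℕ → Set
Gapped = AllPairs (λ p q → suc q < p)

module _ (n : ℕ) {C : List Edge} (nc : NonCrossing C) where

  private
    found : List Triple
    found = bfilter (isTriangle C) (triples n)

    middle : Triple → ℕ
    middle (i , j , k) = j

    middles : List ℕ
    middles = map middle found

    found⁻ : ∀ {i j k} → (i , j , k) ∈ found →
             (i < j × j < k × k < n) × ((i , j) ∈ C × (j , k) ∈ C × (i , k) ∈ C)
    found⁻ {i} {j} {k} t∈ with ∈-bfilter⁻ _ (triples n) t∈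
    ... | t∈T , tri = ∈-triples⁻ {n} t∈T , isTriangle⁻ {C} {i} {j} {k} tri

  -- If `i < i′`, then `ij` crosses `i′k′`; if `i ≡ i′` and `k < k′`, then `ik` crosses `jk′`. The
  -- other cases are symmetric.
  middle-injective : ∀ {s t} → s ∈ found → t ∈ found → middle s ≡ middle t → s ≡ t
  middle-injective {i , j , k} {i′ , .j , k′} s∈ t∈ refl with found⁻ s∈ | found⁻ t∈
  ... | (i<j , j<k , _) , ij , jk , ik | (i′<j , j<k′ , _) , ij′ , jk′ , ik′ with <-cmp i i′ | <-cmp k k′
  ... | tri< i<i′ _ _ | _ = contradiction (inj₁ (i<i′ , i′<j , j<k′)) (nc ij ik′)
  ... | tri> _ _ i>i′ | _ = contradiction (inj₁ (i>i′ , i<j , j<k)) (nc ij′ ik)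
  ... | tri≈ _ _ _ | tri< k<k′ _ _ = contradiction (inj₁ (i<j , j<k , k<k′)) (nc ik jk′)
  ... | tri≈ _ _ _ | tri> _ _ k>k′ = contradiction (inj₁ (i′<j , j<k′ , k>k′)) (nc ik′ jk)
  ... | tri≈ _ refl _ | tri≈ _ refl _ = refl

  -- A triangle with middle `p` has a side from `p` upwards, one with middle `suc p` a side from
  -- `suc p` downwards. Neither side is the missing edge, so both reach further, and they cross.
  middles-not-adjacent : ∀ {p} → (p , suc p) ∉ C → p ∈ middles → suc p ∉ middles
  middles-not-adjacent {p} p∉ p∈ sp∈ with ∈-map⁻ middle p∈ | ∈-map⁻ middle sp∈
  ... | (a , _ , c) , s∈ , refl | (a′ , _ , c′) , t∈ , refl with found⁻ s∈ | found⁻ t∈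
  ...   | (a<p , p<c , _) , _ , pc , _ | (a′<sp , sp<c′ , _) , a′sp , _ , _ with m≤n⇒m<n∨m≡n p<c | m≤n⇒m<n∨m≡n (s≤s⁻¹ a′<sp)
  ...     | inj₂ refl | _         = p∉ pc
  ...     | inj₁ _    | inj₂ refl = p∉ a′sp
  ...     | inj₁ sp<c | inj₁ a′<p = nc pc a′sp (inj₂ (a′<p , ≤-refl , sp<c))

  private
    -- Of the two endpoints of a missing boundary edge, one that is not the middle vertex of a triangle.
    unused : ℕ → ℕ
    unused p with mem? _≟_ p middles
    ... | yes _ = suc p
    ... | no  _ = p

    unused-lower : ∀ p → p ≤ unused p
    unused-lower p with mem? _≟_ p middles
    ... | yes _ = n≤1+n p
    ... | no  _ = ≤-refl

    unused-upper : ∀ p → unused p ≤ suc p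
    unused-upper p with mem? _≟_ p middles
    ... | yes _ = ≤-refl
    ... | no  _ = n≤1+n p

    unused∉middles : ∀ {p} → (p , suc p) ∉ C → unused p ∉ middles
    unused∉middles {p} p∉ with mem? _≟_ p middles
    ... | yes p∈ = middles-not-adjacent p∉ p∈
    ... | no  p∉ = p∉

  triangles-≤ : ∀ {S} → Gapped S → All (λ p → (p , suc p) ∉ C × suc p < n) S → triangles n C + length S ≤ n
  triangles-≤ {S} gapped missing = begin
    length found + length S                  ≡⟨ cong₂ _+_ (length-map middle found) (length-map unused S) ⟨
    length middles + length (map unused S)   ≡⟨ length-++ middles ⟨
    length (middles ++ map unused S)         ≤⟨ Unique⇒length-≤ distinct (bounded′ ∘ ∈-++⁻ middles) ⟩
    length (upTo n)                          ≡⟨ length-upTo n ⟩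
    n                                        ∎
    where
    open ≤-Reasoning
    distinct : Unique (middles ++ map unused S)
    distinct = Unique.++⁺ (Unique-map middle-injective (Unique-bfilter _ (triples-Unique n)))
      (AllPairs.map⁺ (AllPairs.map
        (λ {p} {q} q<p eq → <-irrefl (sym eq) (≤-<-trans (unused-upper q) (<-≤-trans q<p (unused-lower p)))) gapped))
      (λ (x∈ , x∈′) → case ∈-map⁻ unused x∈′ of λ where
        (p , p∈ , refl) → unused∉middles (proj₁ (All.lookup missing p∈)) x∈)
    bounded′ : ∀ {x} → x ∈ middles ⊎ x ∈ map unused S → x ∈ upTo n
    bounded′ (inj₁ x∈) with ∈-map⁻ middle x∈
    ... | (i , j , k) , t∈ , refl with found⁻ t∈
    ...   | (_ , j<k , k<n) , _ = ∈-upTo⁺ (<-trans j<k k<n)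
    bounded′ (inj₂ x∈) with ∈-map⁻ unused x∈
    ... | p , p∈ , refl = ∈-upTo⁺ (≤-<-trans (unused-upper p) (proj₂ (All.lookup missing p∈)))

-- Blocker's sweep of the boundary.

record Spoiled (n : ℕ) (C B : List Edge) (S : List ℕ) : Set where
  field
    nonCrossing : NonCrossing C
    gapped      : Gapped S
    claimed     : All (λ p → (p , suc p) ∈ B × (p , suc p) ∉ C × suc p < n) S
open Spoiled

nonCrossing-∷ : ∀ {n C B e} → NonCrossing C → Legal n C B e → NonCrossing (e ∷ C)
nonCrossing-∷ nc l (here refl) (here refl) (inj₁ (a<a , _)) = <-irrefl refl a<a
nonCrossing-∷ nc l (here refl) (here refl) (inj₂ (a<a , _)) = <-irrefl refl a<a
nonCrossing-∷ nc l (here refl) (there h∈)  = noncross l h∈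
nonCrossing-∷ nc l (there e∈)  (here refl) = noncross l e∈ ∘ Cross-sym
nonCrossing-∷ nc l (there e∈)  (there h∈)  = nc e∈ h∈

∉-∷ : ∀ {e h : Edge} {C} → e ≢ h → e ∉ C → e ∉ h ∷ C
∉-∷ e≢h e∉ (here e≡h) = e≢h e≡h
∉-∷ e≢h e∉ (there e∈) = e∉ e∈

Spoiled-C : ∀ {n C B S e} → Spoiled n C B S → Legal n C B e → Spoiled n (e ∷ C) B S
Spoiled-C {e = e} s l = record
  { nonCrossing = nonCrossing-∷ (nonCrossing s) l
  ; gapped      = gapped s
  ; claimed     = All.map (λ { (∈B′ , ∉C′ , b) → ∈B′ , ∉-∷ (λ { refl → ∉B (free l) ∈B′ }) ∉C′ , b }) (claimed s)
  }

Spoiled-B : ∀ {n C B S} e → Spoiled n C B S → Spoiled n C (e ∷ B) S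
Spoiled-B e s = record
  { nonCrossing = nonCrossing s
  ; gapped      = gapped s
  ; claimed     = All.map (λ (∈B′ , r) → there ∈B′ , r) (claimed s)
  }

module _ {n v : ℕ} where

  -- Moves of either player preserve `Spoiled`, because Constructor cannot claim an edge of `B`.
  -- Thus `triangles-≤` applies whenever the game ends, and from here on any move of Blocker will
  -- do.
  value-≤-spoiled : ∀ f b {C B S} → Spoiled n C B S → n ≤ v + length S → value n f b C B ≤ v
  value-≤-spoiled f b {C} {B} {S} s n≤ = go f b s
    where
    small : ∀ {C B} → Spoiled n C B S → triangles n C ≤ v
    small {C} s = +-cancelʳ-≤ (length S) (triangles n C) v
      (≤-trans (triangles-≤ n (nonCrossing s) (gapped s) (All.map proj₂ (claimed s))) n≤)
    go : ∀ f b {C B} → Spoiled n C B S → value n f b C B ≤ v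
    go zero    b     s = small s
    go (suc f) true  {C} {B} s = constructor-moves-≤ n f C B (inj₁ (small s)) (λ l → go f false (Spoiled-C s l))
    go (suc f) false {C} {B} s with constructorMoves n C B in eq
    ... | []     = small s
    ... | m ∷ ms = minList-≤-v
      where
      m-free : Unclaimed n C B m
      m-free = free (constructorMoves⁻ (subst (m ∈_) (sym eq) (here refl)))
      minList-≤-v = ≤-trans (minList-≤ (λ e → value n f true C (e ∷ B)) (unclaimed⁺ m-free)) (go f true (Spoiled-B m s))

  -- `S` lists the boundary edges taken by Blocker, each by its lower end, and `U` those he can
  -- still use. By `beyond`, the head of `U` can join `S` without breaking the gaps.
  record Sweeping (C B : List Edge) (S U : List ℕ) : Set where
    field
      spoiled   : Spoiled n C B S
      ascending : AllPairs _<_ U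
      open-path : All (λ u → suc u < n × (u , suc u) ∉ C × (u , suc u) ∉ B) U
      beyond    : All (λ u → All (λ p → suc p < u) S) U
  open Sweeping

  -- Nothing crosses a boundary edge, since no vertex lies strictly between its ends.
  boundary-legal : ∀ {C B u} → suc u < n → (u , suc u) ∉ C → (u , suc u) ∉ B → Legal n C B (u , suc u)
  boundary-legal su<n ∉C ∉B = legal (unclaimed-edge ≤-refl su<n ∉C ∉B) λ where
    _ (inj₁ (u<c , c<su , _)) → <-irrefl refl (<-≤-trans u<c (s≤s⁻¹ c<su))
    _ (inj₂ (_ , u<d , d<su)) → <-irrefl refl (<-≤-trans u<d (s≤s⁻¹ d<su))

  module _ (2n≤3v : 2 * n ≤ 3 * v) where

    -- The remainder 2 disappears on division by 3: `3 * n` is less than `3 * suc (v + s)`.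
    swept-bound : ∀ s → n ≤ 3 * s + 2 → n ≤ v + s
    swept-bound s n≤ = s≤s⁻¹ (*-cancelˡ-< 3 n (suc (v + s)) (begin-strict
      3 * n             ≡⟨ (solve-∀′ n) ⟩
      2 * n + n         ≤⟨ +-mono-≤ 2n≤3v n≤ ⟩
      3 * v + (3 * s + 2) <⟨ ≤-reflexive (solve-∀″ v s) ⟩
      3 * suc (v + s)   ∎))
      where
      open ≤-Reasoning
      solve-∀′ : ∀ n → 3 * n ≡ 2 * n + n
      solve-∀′ = solve-∀
      solve-∀″ : ∀ v s → suc (3 * v + (3 * s + 2)) ≡ 3 * suc (v + s)
      solve-∀″ = solve-∀

    -- The potential is `3 * length S + length U`, at least `n - 1` when Constructor is to move. Her
    -- move takes at most one element out of `U`; Blocker's reply adds one to `S` and removes at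
    -- most `u` and `suc u` from `U`, which restores the loss. Each round shortens `U` and uses two
    -- moves.
    sweep-constructor : ∀ f {C B S U} → Sweeping C B S U → 2 * length U ≤ f →
                         n ≤ suc (3 * length S + length U) → value n f true C B ≤ v
    sweep-blocker : ∀ f {C B S U} → Sweeping C B S U → 2 * length U ≤ suc f →
                     n ≤ 2 + (3 * length S + length U) → value n f false C B ≤ v

    sweep-constructor f {S = S} {[]} s _ n≤ = value-≤-spoiled f true (spoiled s) (swept-bound (length S) (begin
      n                          ≤⟨ n≤ ⟩
      suc (3 * length S + 0)     ≡⟨ cong suc (+-identityʳ _) ⟩
      suc (3 * length S)         ≤⟨ n≤1+n _ ⟩
      2 + 3 * length S           ≡⟨ +-comm 2 _ ⟩
      3 * length S + 2           ∎))
      where open ≤-Reasoning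
    sweep-constructor (suc f) {C} {B} {S} {U@(u ∷ us)} s fuel n≤ =
      -- The first edge of `U` is open to Constructor too, so the game is not over.
      constructor-moves-≤ n f C B (inj₂ (_ , first-legal (open-path s))) after
      where
      open ≤-Reasoning
      first-legal : All _ U → _
      first-legal ((su<n , ∉C , ∉B) ∷ _) = boundary-legal su<n ∉C ∉B
      after : ∀ {e} → Legal n C B e → value n f false (e ∷ C) B ≤ v
      after {e} l = sweep-blocker f {U = without (proj₁ e) U}
        (record { spoiled   = Spoiled-C (spoiled s) l
                ; ascending = AllPairs-without (proj₁ e) (ascending s)
                ; open-path = All.map (λ (u≢ , b , ∉C , ∉B) → b , ∉-∷ (u≢ ∘ cong proj₁) ∉C , ∉B)
                                (All-without (proj₁ e) (open-path s))
                ; beyond    = All.map proj₂ (All-without (proj₁ e) (beyond s)) })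
        (≤-trans (*-monoʳ-≤ 2 (without-length (proj₁ e) U)) fuel)
        (begin
          n                                                      ≤⟨ n≤ ⟩
          suc (3 * length S + length U)                          ≤⟨ s≤s (+-monoʳ-≤ (3 * length S) (length-without (proj₁ e) (ascending s))) ⟩
          suc (3 * length S + suc (length (without (proj₁ e) U))) ≡⟨ cong suc (+-suc _ _) ⟩
          2 + (3 * length S + length (without (proj₁ e) U))      ∎)

    sweep-blocker f {S = S} {[]} s _ n≤ = value-≤-spoiled f false (spoiled s)
      (swept-bound (length S) (≤-trans n≤ (≤-reflexive (trans (cong (2 +_) (+-identityʳ _)) (+-comm 2 _)))))
    sweep-blocker zero {U = u ∷ us} s fuel n≤ =
      contradiction (subst (_≤ 1) (*-suc 2 (length us)) fuel) λ { (s≤s ()) }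
    sweep-blocker (suc f) {C} {B} {S} {u ∷ us}
      record { spoiled = sp ; ascending = u< ∷ us< ; open-path = (su<n , ∉C , ∉B) ∷ op ; beyond = bu ∷ bs } fuel n≤ =
      blocker-move-≤ n f C B (boundary-legal su<n ∉C ∉B) (sweep-constructor f {S = u ∷ S} {U = without (suc u) us}
        (record { spoiled   = record { nonCrossing = nonCrossing sp
                                     ; gapped      = bu ∷ gapped sp
                                     ; claimed     = (here refl , ∉C , su<n) ∷ claimed (Spoiled-B _ sp) }
                ; ascending = AllPairs-without (suc u) us<
                ; open-path = All.map (λ (_ , u<w , b , ∉C , ∉B) → b , ∉C , ∉-∷ (λ eq → <⇒≢ u<w (sym (cong proj₁ eq))) ∉B)
                                (All-without (suc u) (All.zip (u< , op)))
                ; beyond    = All.map (λ (w≢su , u<w , bw) → ≤∧≢⇒< u<w (≢-sym w≢su) ∷ bw)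
                                (All-without (suc u) (All.zip (u< , bs))) })
        (≤-trans (*-monoʳ-≤ 2 (without-length (suc u) us))
          (s≤s⁻¹ (s≤s⁻¹ (subst (_≤ 2 + f) (*-suc 2 (length us)) fuel))))
        (begin
          n                                                        ≤⟨ n≤ ⟩
          2 + (3 * length S + suc (length us))                     ≤⟨ +-monoʳ-≤ 2 (+-monoʳ-≤ (3 * length S) (s≤s (length-without (suc u) us<))) ⟩
          2 + (3 * length S + suc (suc (length (without (suc u) us)))) ≡⟨ regroup (length S) _ ⟩
          suc (3 * suc (length S) + length (without (suc u) us))   ∎))
      where
      open ≤-Reasoning
      regroup : ∀ s w → 2 + (3 * s + suc (suc w)) ≡ suc (3 * suc s + w)
      regroup = solve-∀

gECB-upper : ∀ {n} → 9 ≤ n → 3 * gECB n ≤ 2 * n + 2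
gECB-upper {n} 9≤n = ≮⇒≥ (too-big (gECB n) refl)
  where
  fuel : 2 * length (upTo (pred n)) ≤ length (edges n)
  fuel rewrite length-upTo (pred n) =
    ≤-trans (*-mono-≤ {2} {4} (m≤m+n 2 2) (pred[n]≤n {n})) (4*n≤length-edges 9≤n)

  n≤1+pred : n ≤ suc (length (upTo (pred n)))
  n≤1+pred rewrite length-upTo (pred n) = suc-pred-≤ n
    where
    suc-pred-≤ : ∀ n → n ≤ suc (pred n)
    suc-pred-≤ zero    = z≤n
    suc-pred-≤ (suc n) = ≤-refl

  in-range : ∀ {n u} → u < pred n → suc u < n
  in-range {suc n} u<n = s≤s u<n

  too-big : ∀ g → gECB n ≡ g → ¬ (2 * n + 2 < 3 * g)
  too-big zero    _  lt = contradiction lt λ ()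
  -- If the value `suc v` were too big, then `2 * n ≤ 3 * v`, and the sweep would hold it down to
  -- `v`.
  too-big (suc v) eq lt = <-irrefl eq (s≤s (sweep-constructor {n} {v} 2n≤3v (length (edges n))
    (record
      { spoiled   = record { nonCrossing = λ () ; gapped = [] ; claimed = [] }
      ; ascending = AllPairs.applyUpTo⁺₁ id (pred n) (λ i<j _ → i<j)
      ; open-path = All.tabulate (λ u∈ → in-range (∈-upTo⁻ u∈) , (λ ()) , (λ ()))
      ; beyond    = All.universal (λ _ → []) _ })
    fuel n≤1+pred))
    where
    2n≤3v : 2 * n ≤ 3 * v
    2n≤3v = +-cancelʳ-≤ 3 (2 * n) (3 * v) (begin
      2 * n + 3       ≡⟨ +-suc (2 * n) 2 ⟩
      suc (2 * n + 2) ≤⟨ lt ⟩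
      3 * suc v       ≡⟨ *-suc 3 v ⟩
      3 + 3 * v       ≡⟨ +-comm 3 (3 * v) ⟩
      3 * v + 3       ∎)
      where open ≤-Reasoning

-- Constructor's strategy

bit : Bool → ℕ
bit false = 0
bit true  = 1

bit≤1 : ∀ b → bit b ≤ 1
bit≤1 false = z≤n
bit≤1 true  = ≤-refl

-- Counting B-edges among the vertices of a path.

opaque
  adj : List Edge → ℕ → ℕ → Bool
  adj B x y = ((x , y) ∈ᵇ B) ∨ ((y , x) ∈ᵇ B)

  deg : List Edge → ℕ → List ℕ → ℕ
  deg B v []       = 0
  deg B v (x ∷ xs) = bit (adj B v x) + deg B v xs

  inside : List Edge → List ℕ → ℕ
  inside B []       = 0
  inside B (x ∷ xs) = deg B x xs + inside B xs

  -- The B-edges among t ∷ xs ∷ʳ z other than the closing edge tz, which is never needed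
  -- for a chord that leaves out some interior vertex.
  inner : List Edge → ℕ → List ℕ → ℕ → ℕ
  inner B t xs z = deg B t xs + (deg B z xs + inside B xs)

opaque
  unfolding adj

  adj-sym : ∀ B x y → adj B x y ≡ adj B y x
  adj-sym B x y = ∨-comm ((x , y) ∈ᵇ B) ((y , x) ∈ᵇ B)

pop-regroup : ∀ d e i k l → suc (d + (e + i)) ≤ suc k + ((l + e) + (d + i))
pop-regroup d e i k l = s≤s (≤-trans (m≤m+n _ (k + l)) (≤-reflexive (swap d e i k l)))
  where
  swap : ∀ d e i k l → d + (e + i) + (k + l) ≡ k + ((l + e) + (d + i))
  swap = solve-∀

module _ (B : List Edge) where

  -- Only B-edges from `q` downwards are excluded; a B-edge from `q` upwards is charged to its
  -- larger end.
  Isolated : ℕ → Set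
  Isolated q = ∀ {e} → e ∈ B → proj₂ e ≢ q

  opaque
    unfolding deg inside inner

    deg-insert : ∀ x pre {v post} → deg B x (pre ++ v ∷ post) ≡ bit (adj B x v) + deg B x (pre ++ post)
    deg-insert x []        = refl
    deg-insert x (y ∷ pre) {v} {post} rewrite deg-insert x pre {v} {post} =
      swap (bit (adj B x y)) (bit (adj B x v)) (deg B x (pre ++ post))
      where
      swap : ∀ a b c → a + (b + c) ≡ b + (a + c)
      swap = solve-∀

    inside-remove : ∀ pre {v post} → inside B (pre ++ v ∷ post) ≡ deg B v (pre ++ post) + inside B (pre ++ post)
    inside-remove []        = refl
    inside-remove (x ∷ pre) {v} {post}
      rewrite deg-insert x pre {v} {post} | inside-remove pre {v} {post} | adj-sym B x v =
      swap (bit (adj B v x)) (deg B x (pre ++ post)) (deg B v (pre ++ post)) (inside B (pre ++ post))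
      where
      swap : ∀ a b c d → (a + b) + (c + d) ≡ (a + c) + (b + d)
      swap = solve-∀

    -- The profit of taking `v` off the path: all its B-edges to the rest, both ends included, leave
    -- the count.
    inner-remove : ∀ t pre {v post} z →
      inner B t (pre ++ v ∷ post) z ≡ deg B v (t ∷ z ∷ pre ++ post) + inner B t (pre ++ post) z
    inner-remove t pre {v} {post} z
      rewrite deg-insert t pre {v} {post} | deg-insert z pre {v} {post} | inside-remove pre {v} {post}
            | adj-sym B t v | adj-sym B z v =
      swap (bit (adj B v t)) (deg B t (pre ++ post)) (bit (adj B v z)) (deg B z (pre ++ post))
           (deg B v (pre ++ post)) (inside B (pre ++ post))
      where
      swap : ∀ a b c d e f → (a + b) + ((c + d) + (e + f)) ≡ (a + (c + e)) + (b + (d + f))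
      swap = solve-∀

    -- When `t` is forgotten, its B-edge to `t′` leaves the count; `t′` becomes the top, so `z t′`
    -- turns into the closing edge and is no longer counted.
    inner-pop : ∀ {t t′ xs z} → adj B t t′ ≡ true → suc (inner B t′ xs z) ≤ inner B t (t′ ∷ xs) z
    inner-pop {t} {t′} {xs} {z} hit rewrite hit =
      pop-regroup (deg B t′ xs) (deg B z xs) (inside B xs) (deg B t xs) (bit (adj B z t′))

    inside≡inner : ∀ t xs z → inside B (z ∷ t ∷ xs) ≡ bit (adj B z t) + inner B t xs z
    inside≡inner t xs z = swap (bit (adj B z t)) (deg B z xs) (deg B t xs) (inside B xs)
      where
      swap : ∀ a b c d → (a + b) + (c + d) ≡ a + (c + (b + d))
      swap = solve-∀

    deg-hit : ∀ {k v x xs} → adj B v x ≡ true → k ≤ deg B v xs → suc k ≤ deg B v (x ∷ xs)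
    deg-hit eq k≤ rewrite eq = s≤s k≤

    deg-miss : ∀ {k v x xs} → k ≤ deg B v xs → k ≤ deg B v (x ∷ xs)
    deg-miss {v = v} {x} k≤ = ≤-trans k≤ (m≤n+m _ (bit (adj B v x)))

    deg≡0 : ∀ {v xs} → deg B v xs ≡ 0 → All (λ x → adj B v x ≡ false) xs
    deg≡0 {xs = []} _ = []
    deg≡0 {v} {x ∷ xs} eq with adj B v x in a
    ... | false = a ∷ deg≡0 eq

    deg-insert₃ : ∀ {v t z ys} x → deg B v (t ∷ z ∷ ys) ≤ deg B v (t ∷ z ∷ x ∷ ys)
    deg-insert₃ {v} {t} {z} x = +-monoʳ-≤ (bit (adj B v t)) (+-monoʳ-≤ (bit (adj B v z)) (m≤n+m _ (bit (adj B v x))))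

    deg≤inner : ∀ t xs z → deg B t xs ≤ inner B t xs z
    deg≤inner t xs z = m≤m+n _ _

    inner-[] : ∀ t z → inner B t [] z ≡ 0
    inner-[] t z = refl

  opaque
    unfolding adj

    adj-false⁻ : ∀ {x y} → adj B x y ≡ false → (y , x) ∉ B
    adj-false⁻ {x} {y} eq yx∈ = ≡false⇒≢true eq (trans (cong (((x , y) ∈ᵇ B) ∨_) (∈ᵇ-complete yx∈)) (∨-zeroʳ _))

    adj-isolated : ∀ {q p} → Isolated q → (∀ {e} → e ∈ B → proj₁ e < proj₂ e) → p < q → adj B q p ≡ false
    adj-isolated {q} {p} iso sorted p<q with adj B q p in eq
    ... | false = refl
    ... | true with ∨-true⁻ {(q , p) ∈ᵇ B} eq
    ...   | inj₁ qp∈ = contradiction (sorted (∈ᵇ-sound {q , p} B qp∈)) (<-asym p<q)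
    ...   | inj₂ pq∈ = contradiction refl (iso (∈ᵇ-sound {p , q} B pq∈))

  opaque
    unfolding deg

    deg-isolated : ∀ {q xs} → Isolated q → (∀ {e} → e ∈ B → proj₁ e < proj₂ e) → All (_< q) xs → deg B q xs ≡ 0
    deg-isolated iso sorted [] = refl
    deg-isolated iso sorted (x<q ∷ xs<q) rewrite adj-isolated iso sorted x<q = deg-isolated iso sorted xs<q

module _ (e : Edge) (B : List Edge) where

  opaque
    unfolding adj

    adj-new : ∀ {x y} → e ≢ (x , y) → e ≢ (y , x) → adj (e ∷ B) x y ≡ adj B x y
    adj-new {x} {y} ≢xy ≢yx
      rewrite ≢true⇒≡false {edge-eq (x , y) e} (λ eq → ≢xy (sym (edge-eq-sound eq)))
            | ≢true⇒≡false {edge-eq (y , x) e} (λ eq → ≢yx (sym (edge-eq-sound eq))) = refl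

    adj-mono : ∀ x y → bit (adj B x y) ≤ bit (adj (e ∷ B) x y)
    adj-mono x y with e ≟ᴱ (x , y) | e ≟ᴱ (y , x)
    ... | no ≢xy   | no ≢yx   = ≤-reflexive (cong bit (sym (adj-new ≢xy ≢yx)))
    ... | yes refl | _        rewrite edge-eq-refl e = bit≤1 _
    ... | no _     | yes refl rewrite edge-eq-refl e | ∨-zeroʳ ((x , y) ∈ᵇ (e ∷ B)) = bit≤1 _

  Meets : ℕ → ℕ → Set
  Meets x y = e ≡ (x , y) ⊎ e ≡ (y , x)

  meets? : ∀ x y → Dec (Meets x y)
  meets? x y = (e ≟ᴱ (x , y)) ⊎-dec (e ≟ᴱ (y , x))

  opaque
    unfolding deg inside

    deg-new : ∀ {v xs} → All (λ x → ¬ Meets v x) xs → deg (e ∷ B) v xs ≡ deg B v xs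
    deg-new []             = refl
    deg-new (¬m ∷ ¬ms) = cong₂ _+_ (cong bit (adj-new (¬m ∘ inj₁) (¬m ∘ inj₂))) (deg-new ¬ms)

    meets-unique : ∀ {v x y} → Meets v x → Meets v y → x ≡ y
    meets-unique (inj₁ refl) (inj₁ refl) = refl
    meets-unique (inj₁ refl) (inj₂ refl) = refl
    meets-unique (inj₂ refl) (inj₁ refl) = refl
    meets-unique (inj₂ refl) (inj₂ refl) = refl

    deg-add : ∀ {v xs} → Unique xs → deg (e ∷ B) v xs ≤ suc (deg B v xs)
    deg-add [] = z≤n
    deg-add {v} {x ∷ xs} (x∉ ∷ xs!) = case meets? v x of λ where
        (yes m) → begin
          bit (adj (e ∷ B) v x) + deg (e ∷ B) v xs ≡⟨ cong (bit (adj (e ∷ B) v x) +_) (deg-new (All.map (λ x≢y m′ → x≢y (meets-unique m m′)) x∉)) ⟩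
          bit (adj (e ∷ B) v x) + deg B v xs       ≤⟨ +-monoˡ-≤ (deg B v xs) (bit≤1 (adj (e ∷ B) v x)) ⟩
          suc (deg B v xs)                         ≤⟨ s≤s (m≤n+m (deg B v xs) (bit (adj B v x))) ⟩
          suc (bit (adj B v x) + deg B v xs)       ∎
        (no ¬m) → begin
          bit (adj (e ∷ B) v x) + deg (e ∷ B) v xs ≡⟨ cong (λ b → bit b + deg (e ∷ B) v xs) (adj-new (¬m ∘ inj₁) (¬m ∘ inj₂)) ⟩
          bit (adj B v x) + deg (e ∷ B) v xs       ≤⟨ +-monoʳ-≤ (bit (adj B v x)) (deg-add xs!) ⟩
          bit (adj B v x) + suc (deg B v xs)       ≡⟨ +-suc (bit (adj B v x)) (deg B v xs) ⟩
          suc (bit (adj B v x) + deg B v xs)       ∎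
      where open ≤-Reasoning

    inside-new : ∀ {c xs} → c ≡ proj₁ e ⊎ c ≡ proj₂ e → All (_≢ c) xs → inside (e ∷ B) xs ≡ inside B xs
    inside-new c∈ [] = refl
    inside-new c∈ (x≢c ∷ xs≢c) = cong₂ _+_ (deg-new (All.map (λ y≢c → avoid c∈ x≢c y≢c) xs≢c)) (inside-new c∈ xs≢c)
      where
      avoid : ∀ {c x y} → c ≡ proj₁ e ⊎ c ≡ proj₂ e → x ≢ c → y ≢ c → ¬ Meets x y
      avoid (inj₁ refl) x≢c y≢c (inj₁ refl) = x≢c refl
      avoid (inj₁ refl) x≢c y≢c (inj₂ refl) = y≢c refl
      avoid (inj₂ refl) x≢c y≢c (inj₁ refl) = y≢c refl
      avoid (inj₂ refl) x≢c y≢c (inj₂ refl) = x≢c refl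

    inside-add : ∀ {xs} → Unique xs → inside (e ∷ B) xs ≤ suc (inside B xs)
    inside-add [] = z≤n
    inside-add {x ∷ xs} (x∉ ∷ xs!) = case Any.any? (meets? x) xs of λ where
        (yes m) → begin
          deg (e ∷ B) x xs + inside (e ∷ B) xs ≡⟨ cong (deg (e ∷ B) x xs +_) (inside-new (endpoint (proj₂ (proj₂ (find m)))) (All.map ≢-sym x∉)) ⟩
          deg (e ∷ B) x xs + inside B xs       ≤⟨ +-monoˡ-≤ (inside B xs) (deg-add xs!) ⟩
          suc (deg B x xs + inside B xs)       ∎
        (no ¬m) → begin
          deg (e ∷ B) x xs + inside (e ∷ B) xs ≡⟨ cong (_+ inside (e ∷ B) xs) (deg-new (All.¬Any⇒All¬ xs ¬m)) ⟩
          deg B x xs + inside (e ∷ B) xs       ≤⟨ +-monoʳ-≤ (deg B x xs) (inside-add xs!) ⟩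
          deg B x xs + suc (inside B xs)       ≡⟨ +-suc (deg B x xs) (inside B xs) ⟩
          suc (deg B x xs + inside B xs)       ∎
      where
      open ≤-Reasoning
      endpoint : ∀ {x y} → Meets x y → x ≡ proj₁ e ⊎ x ≡ proj₂ e
      endpoint (inj₁ refl) = inj₁ refl
      endpoint (inj₂ refl) = inj₂ refl

    -- Reduced to `inside-add` for the whole vertex list by cancelling the closing edge, whose share
    -- can only grow.
    inner-add : ∀ {t xs z} → Unique (z ∷ t ∷ xs) → inner (e ∷ B) t xs z ≤ suc (inner B t xs z)
    inner-add {t} {xs} {z} u = +-cancelˡ-≤ (bit (adj (e ∷ B) z t)) _ _ (begin
      bit (adj (e ∷ B) z t) + inner (e ∷ B) t xs z ≡⟨ inside≡inner (e ∷ B) t xs z ⟨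
      inside (e ∷ B) (z ∷ t ∷ xs)                  ≤⟨ inside-add u ⟩
      suc (inside B (z ∷ t ∷ xs))                  ≡⟨ cong suc (inside≡inner B t xs z) ⟩
      suc (bit (adj B z t) + inner B t xs z)       ≡⟨ +-suc _ _ ⟨
      bit (adj B z t) + suc (inner B t xs z)       ≤⟨ +-monoˡ-≤ _ (adj-mono z t) ⟩
      bit (adj (e ∷ B) z t) + suc (inner B t xs z) ∎)
      where open ≤-Reasoning

  -- Meant for an edge of a reserved pair: one of its ends is off the path, so Blocker's claiming it
  -- costs nothing in the count.
  inner-off : ∀ {t xs z} → All (_≢ proj₁ e) (z ∷ t ∷ xs) ⊎ All (_≢ proj₂ e) (z ∷ t ∷ xs) →
              inner (e ∷ B) t xs z ≤ inner B t xs z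
  inner-off {t} {xs} {z} off = +-cancelˡ-≤ (bit (adj (e ∷ B) z t)) _ _ (begin
    bit (adj (e ∷ B) z t) + inner (e ∷ B) t xs z ≡⟨ inside≡inner (e ∷ B) t xs z ⟨
    inside (e ∷ B) (z ∷ t ∷ xs)                  ≡⟨ [ inside-new (inj₁ refl) , inside-new (inj₂ refl) ]′ off ⟩
    inside B (z ∷ t ∷ xs)                        ≡⟨ inside≡inner B t xs z ⟩
    bit (adj B z t) + inner B t xs z             ≤⟨ +-monoˡ-≤ _ (adj-mono z t) ⟩
    bit (adj (e ∷ B) z t) + inner B t xs z       ∎)
    where open ≤-Reasoning

opaque
  unfolding adj deg inside

  deg-[] : ∀ v xs → deg [] v xs ≡ 0
  deg-[] v []       = refl
  deg-[] v (x ∷ xs) = deg-[] v xs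

  inside-[] : ∀ xs → inside [] xs ≡ 0
  inside-[] []       = refl
  inside-[] (x ∷ xs) = cong₂ _+_ (deg-[] x xs) (inside-[] xs)

-- Paths, listed from the highest vertex down, all of whose chords are still playable.

Uncovered : List Edge → ℕ → Set
Uncovered C p = ∀ {h} → h ∈ C → ¬ (proj₁ h < p × p < proj₂ h)

record Path (n : ℕ) (C : List Edge) (L : List ℕ) : Set where
  field
    descending : AllPairs _>_ L
    bounded-by : All (_< n) L
    linked     : Linked (λ u w → (w , u) ∈ C) L
    uncovered  : All (Uncovered C) L
open Path

All-splice : ∀ {P : ℕ → Set} A {u} M {w D} → All P (A ++ u ∷ M ++ w ∷ D) → All P (A ++ u ∷ w ∷ D)
All-splice A M ps with All.++⁻ A ps
... | pA , pu ∷ pM = All.++⁺ pA (pu ∷ All.++⁻ʳ M pM)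

AllPairs-++⁻ʳ : ∀ {R : ℕ → ℕ → Set} M {D} → AllPairs R (M ++ D) → AllPairs R D
AllPairs-++⁻ʳ []      rs       = rs
AllPairs-++⁻ʳ (_ ∷ M) (_ ∷ rs) = AllPairs-++⁻ʳ M rs

AllPairs-splice : ∀ {R : ℕ → ℕ → Set} A {u} M {w D} →
                  AllPairs R (A ++ u ∷ M ++ w ∷ D) → AllPairs R (A ++ u ∷ w ∷ D)
AllPairs-splice []      M (r ∷ rs) = All.++⁻ʳ M r ∷ AllPairs-++⁻ʳ M rs
AllPairs-splice (_ ∷ A) M (r ∷ rs) = All-splice A M r ∷ AllPairs-splice A M rs

Linked-++⁻ʳ : ∀ {R : ℕ → ℕ → Set} M {D} → Linked R (M ++ D) → Linked R D
Linked-++⁻ʳ []            rs       = rs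
Linked-++⁻ʳ (_ ∷ []) {[]} _        = []
Linked-++⁻ʳ (_ ∷ []) {_ ∷ _} (_ ∷ rs) = rs
Linked-++⁻ʳ (_ ∷ x ∷ M)   (_ ∷ rs) = Linked-++⁻ʳ (x ∷ M) rs

Linked-splice : ∀ {R : ℕ → ℕ → Set} A {u} M {w D} → R u w →
                Linked R (A ++ u ∷ M ++ w ∷ D) → Linked R (A ++ u ∷ w ∷ D)
Linked-splice []          {u} M Ruw rs = Ruw ∷ Linked-++⁻ʳ (u ∷ M) rs
Linked-splice (_ ∷ [])    M Ruw (r ∷ rs) = r ∷ Linked-splice [] M Ruw rs
Linked-splice (_ ∷ x ∷ A) M Ruw (r ∷ rs) = r ∷ Linked-splice (x ∷ A) M Ruw rs

not-between : ∀ A {u w D} → AllPairs _>_ (A ++ u ∷ w ∷ D) → All (λ p → ¬ (w < p × p < u)) (A ++ u ∷ w ∷ D)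
not-between [] ((w<u ∷ _) ∷ D< ∷ _) =
  (λ (_ , u<u) → <-irrefl refl u<u) ∷ (λ (w<w , _) → <-irrefl refl w<w) ∷ All.map (λ p<w (w<p , _) → <-asym p<w w<p) D<
not-between (a ∷ A) (a> ∷ rs) = (λ (_ , a<u) → <-asym a<u (All.lookup a> (∈-++⁺ʳ A (here refl)))) ∷ not-between A rs

-- Of the path vertices, only the dropped block `M` lies below the new chord.
path-splice : ∀ {n C} A {u} M {w D} → Path n C (A ++ u ∷ M ++ w ∷ D) → Path n ((w , u) ∷ C) (A ++ u ∷ w ∷ D)
path-splice A M p = record
  { descending = desc
  ; bounded-by = All-splice A M (bounded-by p)
  ; linked     = Linked-splice A M (here refl) (Linked.map there (linked p))
  ; uncovered  = All.zipWith (λ { (unc , out) (here refl) → out ; (unc , out) (there h∈) → unc h∈ })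
                   (All-splice A M (uncovered p) , not-between A desc)
  }
  where desc = AllPairs-splice A M (descending p)

-- An edge crossing `wu` would have `w` or `u` strictly below it. The vertex `m` shows that `wu` is
-- not claimed yet, as it would lie below that edge.
chord-legal : ∀ {n C B w m u} → w < m → m < u → u < n → Uncovered C w → Uncovered C m → Uncovered C u →
              adj B u w ≡ false → Legal n C B (w , u)
chord-legal {B = B} w<m m<u u<n uncw uncm uncu a = legal
  (unclaimed-edge (<-trans w<m m<u) u<n (λ wu∈ → uncm wu∈ (w<m , m<u)) (adj-false⁻ B a))
  λ where
    h∈ (inj₁ (_ , c<u , u<d)) → uncu h∈ (c<u , u<d)
    h∈ (inj₂ (c<w , w<d , _)) → uncw h∈ (c<w , w<d)

path-grow : ∀ {n C L} g → Path n C L → All (λ p → ¬ (proj₁ g < p × p < proj₂ g)) L → Path n (g ∷ C) L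
path-grow g p out = record
  { descending = descending p
  ; bounded-by = bounded-by p
  ; linked     = Linked.map there (linked p)
  ; uncovered  = All.zipWith (λ { (unc , o) (here refl) → o ; (unc , o) (there h∈) → unc h∈ }) (uncovered p , out)
  }

path-tail : ∀ {n C x L} → Path n C (x ∷ L) → Path n C L
path-tail p = record
  { descending = AllPairs.tail (descending p)
  ; bounded-by = All.tail (bounded-by p)
  ; linked     = Linked.tail (linked p)
  ; uncovered  = All.tail (uncovered p)
  }

-- Reserved pairs: two crossing edges, each of which completes a triangle for Constructor,
-- so that she gets a triangle whichever of them Blocker takes.

Pair : Set
Pair = Edge × Edge

Of : Pair → Edge → Set
Of (f , g) e = e ≡ f ⊎ e ≡ g

Compatible : Edge → Edge → Set
Compatible e h = e ≢ h × ¬ Cross e h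

-- `shielding` keeps the path uncovered after `e` is played; `off-path` keeps `e` out of the count
-- of B-edges and makes it differ from every chord of the path.
record Ready (n : ℕ) (C B : List Edge) (L : List ℕ) (e : Edge) : Set where
  field
    playable  : Legal n C B e
    scoring   : Completes n C e
    shielding : All (λ p → ¬ (proj₁ e < p × p < proj₂ e)) L
    off-path  : All (_≢ proj₁ e) L ⊎ All (_≢ proj₂ e) L
open Ready

completes-mono : ∀ {n C e} h → Completes n C e → Completes n (h ∷ C) e
completes-mono {e = e} h (completes i<j j<k k<n ij jk ik e∈) = completes i<j j<k k<n (weaken ij) (weaken jk) (weaken ik) e∈
  where
  weaken : ∀ {x C} → x ∈ e ∷ C → x ∈ e ∷ h ∷ C
  weaken (here eq)  = here eq
  weaken (there x∈) = there (there x∈)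

legal-C : ∀ {n C B e h} → Compatible e h → Legal n C B e → Legal n (h ∷ C) B e
legal-C (e≢h , ¬cr) l = legal
  (unclaimed-edge (ordered (free l)) (bounded (free l)) (∉-∷ e≢h (∉C (free l))) (∉B (free l)))
  λ { (here refl) → ¬cr ; (there h∈) → noncross l h∈ }

legal-B : ∀ {n C B e h} → e ≢ h → Legal n C B e → Legal n C (h ∷ B) e
legal-B e≢h l = legal
  (unclaimed-edge (ordered (free l)) (bounded (free l)) (∉C (free l)) (∉-∷ e≢h (∉B (free l)))) (noncross l)

ready-C : ∀ {n C B L e h} → Compatible e h → Ready n C B L e → Ready n (h ∷ C) B L e
ready-C c r = record
  { playable = legal-C c (playable r) ; scoring = completes-mono _ (scoring r)
  ; shielding = shielding r ; off-path = off-path r }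

ready-B : ∀ {n C B L e h} → e ≢ h → Ready n C B L e → Ready n C (h ∷ B) L e
ready-B e≢h r = record
  { playable = legal-B e≢h (playable r) ; scoring = scoring r ; shielding = shielding r ; off-path = off-path r }

ready-L : ∀ {n C B L L′ e} → (∀ {P : ℕ → Set} → All P L → All P L′) → Ready n C B L e → Ready n C B L′ e
ready-L sub r = record
  { playable = playable r ; scoring = scoring r ; shielding = sub (shielding r)
  ; off-path = [ inj₁ ∘ sub , inj₂ ∘ sub ]′ (off-path r) }

-- A chord crossing `e` would have one of its ends, a path vertex, strictly below `e`, against
-- `shielding`.
ready-chord : ∀ {n C B L e u w} → Ready n C B L e → u ∈ L → w ∈ L → Compatible e (w , u)
ready-chord r u∈ w∈ =
  (λ { refl → [ (λ ≢a → All.lookup ≢a w∈ refl) , (λ ≢d → All.lookup ≢d u∈ refl) ]′ (off-path r) }) ,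
  (λ { (inj₁ (a<w , w<d , _)) → All.lookup (shielding r) w∈ (a<w , w<d)
     ; (inj₂ (_ , a<u , u<d)) → All.lookup (shielding r) u∈ (a<u , u<d) })

Independent : Pair → Pair → Set
Independent q q′ = ∀ e e′ → Of q e → Of q′ e′ → Compatible e e′

compatible-sym : ∀ {e h} → Compatible e h → Compatible h e
compatible-sym (e≢h , ¬cr) = ≢-sym e≢h , ¬cr ∘ Cross-sym

record Reserves (n : ℕ) (C B : List Edge) (L : List ℕ) (Q : List Pair) : Set where
  field
    distinct    : All (λ q → proj₁ q ≢ proj₂ q) Q
    ready       : All (λ q → ∀ e → Of q e → Ready n C B L e) Q
    independent : AllPairs Independent Q
open Reserves

reserves-[] : ∀ {n C B L} → Reserves n C B L []
reserves-[] = record { distinct = [] ; ready = [] ; independent = [] }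

reserves-L : ∀ {n C B L L′ Q} → (∀ {P : ℕ → Set} → All P L → All P L′) → Reserves n C B L Q → Reserves n C B L′ Q
reserves-L sub r = record
  { distinct = distinct r ; ready = All.map (λ rd _ o → ready-L sub (rd _ o)) (ready r) ; independent = independent r }

reserves-chord : ∀ {n C B L Q u w} → Reserves n C B L Q → u ∈ L → w ∈ L → Reserves n ((w , u) ∷ C) B L Q
reserves-chord r u∈ w∈ = record
  { distinct    = distinct r
  ; ready       = All.map (λ rd _ o → ready-C (ready-chord (rd _ o) u∈ w∈) (rd _ o)) (ready r)
  ; independent = independent r }

All-remove : ∀ {P : Pair → Set} Q₁ {q Q₂} → All P (Q₁ ++ q ∷ Q₂) → P q × All P (Q₁ ++ Q₂)
All-remove Q₁ ps with All.++⁻ Q₁ ps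
... | p₁ , p ∷ p₂ = p , All.++⁺ p₁ p₂

independent-remove : ∀ Q₁ {q Q₂} → AllPairs Independent (Q₁ ++ q ∷ Q₂) →
                     All (λ q′ → Independent q′ q) (Q₁ ++ Q₂) × AllPairs Independent (Q₁ ++ Q₂)
independent-remove []       (i ∷ is) = All.map (λ ind _ _ o o′ → compatible-sym (ind _ _ o′ o)) i , is
independent-remove (_ ∷ Q₁) (i ∷ is) with All-remove Q₁ i | independent-remove Q₁ is
... | iq , i′ | js , is′ = iq ∷ js , i′ ∷ is′

module _ {n C B L} Q₁ {q Q₂} (r : Reserves n C B L (Q₁ ++ q ∷ Q₂)) where

  -- Playing `g` uses up the whole pair, as `g` may cross its partner; independence saves all other
  -- pairs.
  reserves-cash : ∀ {g} → Of q g → Reserves n (g ∷ C) B L (Q₁ ++ Q₂)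
  reserves-cash o with independent-remove Q₁ (independent r)
  ... | iq , is = record
    { distinct    = proj₂ (All-remove Q₁ (distinct r))
    ; ready       = All.zipWith (λ { (rd , ind) _ o′ → ready-C (ind _ _ o′ o) (rd _ o′) }) (proj₂ (All-remove Q₁ (ready r)) , iq)
    ; independent = is }

  partner : ∀ {e} → Of q e → Σ[ g ∈ Edge ] Of q g × g ≢ e
  partner (inj₁ refl) = _ , inj₂ refl , ≢-sym (proj₁ (All-remove Q₁ (distinct r)))
  partner (inj₂ refl) = _ , inj₁ refl , proj₁ (All-remove Q₁ (distinct r))

reserves-cash-after : ∀ {n C B L e g} Q₁ {q Q₂} → Reserves n C B L (Q₁ ++ q ∷ Q₂) → Of q e → Of q g →
                      Reserves n (g ∷ C) (e ∷ B) L (Q₁ ++ Q₂)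
reserves-cash-after Q₁ r oe og with independent-remove Q₁ (independent r)
... | iq , is = record
  { distinct    = proj₂ (All-remove Q₁ (distinct r))
  ; ready       = All.zipWith (λ { (rd , ind) _ o → ready-B (proj₁ (ind _ _ o oe)) (ready-C (ind _ _ o og) (rd _ o)) })
                    (proj₂ (All-remove Q₁ (ready r)) , iq)
  ; independent = is }

-- Blocker's edge e either leaves all reserved pairs intact, or Constructor answers with the partner g of e.
data Reaction (n : ℕ) (C B : List Edge) (L : List ℕ) (Q : List Pair) (e : Edge) : Set where
  intact : Reserves n C (e ∷ B) L Q → Reaction n C B L Q e
  answer : ∀ {g Q′} → (All (_≢ proj₁ e) L ⊎ All (_≢ proj₂ e) L) → length Q ≡ suc (length Q′) →
           Ready n C (e ∷ B) L g →
           Reserves n (g ∷ C) (e ∷ B) L Q′ → Reaction n C B L Q e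

of? : ∀ e q → Dec (Of q e)
of? e (f , g) = (e ≟ᴱ f) ⊎-dec (e ≟ᴱ g)

react : ∀ {n C B L Q} → Reserves n C B L Q → ∀ e → Reaction n C B L Q e
react {Q = Q} r e with Any.any? (of? e) Q
... | no ¬hit = intact (record
  { distinct    = distinct r
  ; ready       = All.zipWith (λ { (rd , ¬o) _ o′ → ready-B (λ { refl → ¬o o′ }) (rd _ o′) }) (ready r , All.¬Any⇒All¬ Q ¬hit)
  ; independent = independent r })
... | yes hit with find hit
...   | q , q∈ , o with ∈-∃++ q∈
...     | Q₁ , Q₂ , refl with partner Q₁ r o
...       | g , og , g≢e = answer (off-path (proj₁ (All-remove Q₁ (ready r)) _ o)) (trans (length-++ Q₁) (trans (+-suc _ _) (cong suc (sym (length-++ Q₁)))))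
            (ready-B g≢e (proj₁ (All-remove Q₁ (ready r)) _ og)) (reserves-cash-after Q₁ r o og)

-- Positions with a path and reserved pairs.

record State (n : ℕ) (C B : List Edge) (L : List ℕ) (Q : List Pair) : Set where
  constructor state
  field
    path     : Path n C L
    reserves : Reserves n C B L Q
open State

-- The ends `t` and `z` are kept apart because only the interior vertices `xs` count as future
-- triangles.
full : ℕ → List ℕ → ℕ → List ℕ
full t xs z = t ∷ xs ++ z ∷ []

module _ {n C B Q} A {u m} M {w D} (s : State n C B (A ++ u ∷ m ∷ M ++ w ∷ D) Q) (a : adj B u w ≡ false) where

  splice-legal : Legal n C B (w , u)
  splice-legal with AllPairs-++⁻ʳ A (descending (path s)) | All.++⁻ʳ A (bounded-by (path s)) | All.++⁻ʳ A (uncovered (path s))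
  ... | (u>m ∷ _) ∷ (m> ∷ _) | u<n ∷ _ | uncu ∷ uncm ∷ unc =
    chord-legal (All.head (All.++⁻ʳ M m>)) u>m u<n (All.head (All.++⁻ʳ M unc)) uncm uncu a

  splice-state : State n ((w , u) ∷ C) B (A ++ u ∷ w ∷ D) Q
  splice-state = state (path-splice A (m ∷ M) (path s))
    (reserves-L (All-splice A (m ∷ M)) (reserves-chord (reserves s)
      (∈-++⁺ʳ A (here refl)) (∈-++⁺ʳ A (there (∈-++⁺ʳ (m ∷ M) (here refl))))))

cut-completes : ∀ {n C B Q} A {u m w D} → State n C B (A ++ u ∷ m ∷ w ∷ D) Q → Completes n C (w , u)
cut-completes A s with AllPairs-++⁻ʳ A (descending (path s)) | All.++⁻ʳ A (bounded-by (path s)) | Linked-++⁻ʳ A (linked (path s))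
... | (u>m ∷ _) ∷ (m>w ∷ _) ∷ _ | u<n ∷ _ | mu∈ ∷ wm∈ ∷ _ =
  completes m>w u>m u<n (there wm∈) (there mu∈) (here refl) (there (there (here refl)))

-- The chord `wu` closes a pentagon with the path. Its diagonals `wb` and `du` cross each other;
-- with the path edge `bu` or `wd` and the side `wu`, each completes a triangle.
module _ {n C B Q} A {u b c d w D} (s : State n C B (A ++ u ∷ b ∷ c ∷ d ∷ w ∷ D) Q)
         (uw : adj B u w ≡ false) (bw : adj B b w ≡ false) (ud : adj B u d ≡ false) where

  pentagon-state : State n ((w , u) ∷ C) B (A ++ u ∷ w ∷ D) (((w , b) , (d , u)) ∷ Q)
  pentagon-state with AllPairs-++⁻ʳ A (descending (path s)) | All.++⁻ʳ A (bounded-by (path s))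
                    | All.++⁻ʳ A (uncovered (path s)) | Linked-++⁻ʳ A (linked (path s))
  ... | (u>b ∷ _ ∷ u>d ∷ u>w ∷ _) ∷ (b>c ∷ b>d ∷ b>w ∷ _) ∷ (c>d ∷ c>w ∷ _) ∷ (d>w ∷ _) ∷ _
      | u<n ∷ b<n ∷ _ | uncu ∷ uncb ∷ uncc ∷ uncd ∷ uncw ∷ _ | bu∈ ∷ _ ∷ _ ∷ wd∈ ∷ _ = state (path s′)
    (record
      { distinct    = (λ eq → <⇒≢ u>b (cong proj₂ eq)) ∷ distinct (reserves s′)
      ; ready       = (λ { _ (inj₁ refl) → ready-wb ; _ (inj₂ refl) → ready-du }) ∷ ready (reserves s′)
      -- Both diagonals are chords of the old path, so they are compatible with every edge reserved
      -- on it.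
      ; independent = All.map (λ rd → λ { _ _ (inj₁ refl) o → compatible-sym (ready-chord (rd _ o) (at (there (here refl))) w∈)
                                        ; _ _ (inj₂ refl) o → compatible-sym (ready-chord (rd _ o) u∈ (at (there (there (there (here refl)))))) })
                        (ready (reserves s))
                      ∷ independent (reserves s′) })
    where
    s′ : State n ((w , u) ∷ C) B (A ++ u ∷ w ∷ D) Q
    s′ = splice-state A (c ∷ d ∷ []) s uw
    at : ∀ {x} → x ∈ u ∷ b ∷ c ∷ d ∷ w ∷ D → x ∈ A ++ u ∷ b ∷ c ∷ d ∷ w ∷ D
    at = ∈-++⁺ʳ A
    u∈ = at (here refl)
    w∈ = at (there (there (there (there (here refl)))))
    outside : All (λ p → ¬ (w < p × p < u)) (A ++ u ∷ w ∷ D)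
    outside = not-between A (descending (path s′))
    ready-wb : Ready n ((w , u) ∷ C) B (A ++ u ∷ w ∷ D) (w , b)
    ready-wb = record
      { playable  = legal-C ((λ eq → <⇒≢ u>b (cong proj₂ eq)) ,
                             (λ { (inj₁ (w<w , _)) → <-irrefl refl w<w ; (inj₂ (w<w , _)) → <-irrefl refl w<w }))
                      (chord-legal c>w b>c b<n uncw uncc uncb bw)
      ; scoring   = completes b>w u>b u<n (here refl) (there (there bu∈)) (there (here refl)) (here refl)
      ; shielding = All.map (λ out (w<p , p<b) → out (w<p , <-trans p<b u>b)) outside
      ; off-path  = inj₂ (All.map (λ { out refl → out (b>w , u>b) }) outside) }
    ready-du : Ready n ((w , u) ∷ C) B (A ++ u ∷ w ∷ D) (d , u)
    ready-du = record
      { playable  = legal-C ((λ eq → <⇒≢ d>w (sym (cong proj₁ eq))) ,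
                             (λ { (inj₁ (_ , _ , u<u)) → <-irrefl refl u<u ; (inj₂ (_ , _ , u<u)) → <-irrefl refl u<u }))
                      (chord-legal c>d (<-trans b>c u>b) u<n uncd uncc uncu ud)
      ; scoring   = completes d>w u>d u<n (there (there wd∈)) (here refl) (there (here refl)) (there (here refl))
      ; shielding = All.map (λ out (d<p , p<u) → out (<-trans d>w d<p , p<u)) outside
      ; off-path  = inj₁ (All.map (λ { out refl → out (d>w , u>d) }) outside) }

-- Using pred in the bound on the loss makes Constructor win back the B-edge that Blocker has just added;
-- if there is no B-edge, then his last move was harmless.  In a stop, k counts forgotten top vertices.
data Step (n : ℕ) (C B : List Edge) (t : ℕ) (xs : List ℕ) (z : ℕ) (Q : List Pair) : Set where
  stop : ∀ k → length xs ≤ 5 + k → 2 * k ≤ pred (inner B t xs z) → Step n C B t xs z Q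
  move : ∀ k {t′ xs′ Q′ e} → Legal n C B e → State n (e ∷ C) B (full t′ xs′ z) Q′ →
         triangles n C + (length Q + length xs) ≤ k + (triangles n (e ∷ C) + (length Q′ + length xs′)) →
         2 * k + inner B t′ xs′ z ≤ pred (inner B t xs z) →
         length xs′ + length Q′ < length xs + length Q → Step n C B t xs z Q

-- The three kinds of moves and what they cost.

regroup : ∀ T q k l → T + (q + (k + l)) ≡ k + (T + (q + l))
regroup = solve-∀

module _ {n C B t xs z Q} (s : State n C B (full t xs z) Q) where

  -- A jump gives up `suc k` interior vertices, each worth 2, without securing a triangle. So
  -- `2 * suc k` B-edges must go with them, and one more for Blocker's last move.
  splice-step : ∀ {xs′} A {u m} M {w D} k → full t xs z ≡ A ++ u ∷ m ∷ M ++ w ∷ D → full t xs′ z ≡ A ++ u ∷ w ∷ D →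
                adj B u w ≡ false → length xs ≡ suc k + length xs′ →
                suc (2 * suc k) + inner B t xs′ z ≤ inner B t xs z → Step n C B t xs z Q
  splice-step {xs′} A {u} M {w} k eq eq′ a len loss =
    move (suc k) (splice-legal A M s′ a) (subst (λ L → State n ((w , u) ∷ C) B L Q) (sym eq′) (splice-state A M s′ a))
      (begin
        triangles n C + (length Q + length xs)               ≡⟨ cong (λ l → triangles n C + (length Q + l)) len ⟩
        triangles n C + (length Q + (suc k + length xs′))    ≡⟨ regroup (triangles n C) (length Q) (suc k) (length xs′) ⟩
        suc k + (triangles n C + (length Q + length xs′))    ≤⟨ +-monoʳ-≤ (suc k) (+-monoˡ-≤ _ (triangles-mono n (w , u) C)) ⟩
        suc k + (triangles n ((w , u) ∷ C) + (length Q + length xs′)) ∎)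
      (pred-mono-≤ loss)
      (+-monoˡ-< (length Q) (subst (length xs′ <_) (sym len) (s≤s (m≤n+m (length xs′) k))))
    where
    open ≤-Reasoning
    s′ = subst (λ L → State n C B L Q) eq s

  -- An ear trades an interior vertex for a triangle at no loss, so only the B-edge taken off by
  -- `pred` has to go.
  cut-step : ∀ {xs′} A {u m w D} → full t xs z ≡ A ++ u ∷ m ∷ w ∷ D → full t xs′ z ≡ A ++ u ∷ w ∷ D →
             adj B u w ≡ false → length xs ≡ suc (length xs′) →
             inner B t xs′ z ≤ pred (inner B t xs z) → Step n C B t xs z Q
  cut-step {xs′} A {u} {w = w} eq eq′ a len loss =
    move 0 l (subst (λ L → State n ((w , u) ∷ C) B L Q) (sym eq′) (splice-state A [] s′ a))
      (begin
        triangles n C + (length Q + length xs)               ≡⟨ cong (λ l → triangles n C + (length Q + l)) len ⟩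
        triangles n C + (length Q + suc (length xs′))        ≡⟨ regroup (triangles n C) (length Q) 1 (length xs′) ⟩
        suc (triangles n C) + (length Q + length xs′)        ≤⟨ +-monoˡ-≤ _ (triangles-completes (∉C (free l)) (cut-completes A s′)) ⟩
        triangles n ((w , u) ∷ C) + (length Q + length xs′)  ∎)
      loss
      (+-monoˡ-< (length Q) (subst (length xs′ <_) (sym len) ≤-refl))
    where
    open ≤-Reasoning
    s′ = subst (λ L → State n C B L Q) eq s
    l = splice-legal A [] s′ a

  -- Three vertices go and a reserved pair comes, a net loss of two units worth 2 each; with one
  -- B-edge for Blocker's last move this makes 5.
  pentagon-step : ∀ {xs′} A {u b c d w D} → full t xs z ≡ A ++ u ∷ b ∷ c ∷ d ∷ w ∷ D → full t xs′ z ≡ A ++ u ∷ w ∷ D →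
                  adj B u w ≡ false → adj B b w ≡ false → adj B u d ≡ false → length xs ≡ 3 + length xs′ →
                  5 + inner B t xs′ z ≤ inner B t xs z → Step n C B t xs z Q
  pentagon-step {xs′} A {u} {b} {c} {d} {w} eq eq′ uw bw ud len loss =
    move 2 (splice-legal A (c ∷ d ∷ []) s′ uw)
      (subst (λ L → State n ((w , u) ∷ C) B L (((w , b) , (d , u)) ∷ Q)) (sym eq′) (pentagon-state A s′ uw bw ud))
      (begin
        triangles n C + (length Q + length xs)                    ≡⟨ cong (λ l → triangles n C + (length Q + l)) len ⟩
        triangles n C + (length Q + (3 + length xs′))             ≡⟨ swap (triangles n C) (length Q) (length xs′) ⟩
        2 + (triangles n C + (suc (length Q) + length xs′))       ≤⟨ +-monoʳ-≤ 2 (+-monoˡ-≤ _ (triangles-mono n (w , u) C)) ⟩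
        2 + (triangles n ((w , u) ∷ C) + (suc (length Q) + length xs′)) ∎)
      (pred-mono-≤ loss)
      (subst (λ l → length xs′ + suc (length Q) < l + length Q) (sym len)
        (≤-trans (≤-reflexive (cong suc (+-suc (length xs′) (length Q)))) (n≤1+n _)))
    where
    open ≤-Reasoning
    s′ = subst (λ L → State n C B L Q) eq s
    swap : ∀ T q l → T + (q + (3 + l)) ≡ 2 + (T + (suc q + l))
    swap = solve-∀

-- B-edges that disappear with removed vertices.

infixr 5 _✓_ ─_

-- A lower bound on the degree written as a pattern along the list: `✓` marks a known B-neighbour,
-- `─` skips an entry.
data Hits (B : List Edge) (v : ℕ) : ℕ → List ℕ → Set where
  none : ∀ {xs} → Hits B v 0 xs
  _✓_  : ∀ {k x xs} → adj B v x ≡ true → Hits B v k xs → Hits B v (suc k) (x ∷ xs)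
  ─_   : ∀ {k x xs} → Hits B v k xs → Hits B v k (x ∷ xs)

hits-deg : ∀ {B v k xs} → Hits B v k xs → k ≤ deg B v xs
hits-deg none = z≤n
hits-deg {B} {v} {xs = x ∷ xs} (hit ✓ hits) = deg-hit B {v = v} {x} {xs} hit (hits-deg hits)
hits-deg {B} {v} {xs = x ∷ xs} (─ hits)     = deg-miss B {v = v} {x} {xs} (hits-deg hits)

module _ {B : List Edge} {t z : ℕ} where

  remove₁ : ∀ {k} pre {v post} → Hits B v k (t ∷ z ∷ pre ++ post) →
            k + inner B t (pre ++ post) z ≤ inner B t (pre ++ v ∷ post) z
  remove₁ pre hits = ≤-trans (+-monoˡ-≤ _ (hits-deg hits)) (≤-reflexive (sym (inner-remove B t pre z)))

  -- The vertices are removed one after the other, each with its B-edges to what is left, so no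
  -- B-edge is counted twice.
  remove₂ : ∀ {k l} pre {v w post} → Hits B v k (t ∷ z ∷ pre ++ w ∷ post) → Hits B w l (t ∷ z ∷ pre ++ post) →
            k + (l + inner B t (pre ++ post) z) ≤ inner B t (pre ++ v ∷ w ∷ post) z
  remove₂ {k} pre v-hits w-hits = ≤-trans (+-monoʳ-≤ k (remove₁ pre w-hits)) (remove₁ pre v-hits)

  remove₃ : ∀ {k l m} pre {u v w post} → Hits B u k (t ∷ z ∷ pre ++ v ∷ w ∷ post) →
            Hits B v l (t ∷ z ∷ pre ++ w ∷ post) → Hits B w m (t ∷ z ∷ pre ++ post) →
            k + (l + (m + inner B t (pre ++ post) z)) ≤ inner B t (pre ++ u ∷ v ∷ w ∷ post) z
  remove₃ {k} pre u-hits v-hits w-hits = ≤-trans (+-monoʳ-≤ k (remove₂ pre v-hits w-hits)) (remove₁ pre u-hits)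

length-insert : ∀ (pre : List ℕ) {v post} → length (pre ++ v ∷ post) ≡ suc (length (pre ++ post))
length-insert pre {v} {post} = trans (length-++ pre) (trans (+-suc (length pre) (length post)) (cong suc (sym (length-++ pre))))

flip-adj : ∀ {B} x y → adj B x y ≡ true → adj B y x ≡ true
flip-adj {B} x y = trans (adj-sym B y x)

true-or-false : ∀ b → b ≡ true ⊎ b ≡ false
true-or-false true  = inj₁ refl
true-or-false false = inj₂ refl

-- The first interior vertex v with a B-edge; its predecessor u has none, so the ear of v is free.
data FirstTouched (B : List Edge) (t z : ℕ) : List ℕ → Set where
  at-top : ∀ {v post} → 1 ≤ deg B v (t ∷ z ∷ post) → FirstTouched B t z (v ∷ post)
  below  : ∀ pre {u v post} → 1 ≤ deg B v (t ∷ z ∷ (pre ++ u ∷ []) ++ post) →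
           All (λ w → adj B u w ≡ false) (z ∷ post) → FirstTouched B t z (pre ++ u ∷ v ∷ post)

-- Scan from the top: by `inner-remove`, passing a vertex without B-edges leaves the count
-- unchanged, so some later vertex has one; the last vertex passed serves as `u`.
first-touched : ∀ {B t z} xs → 1 ≤ inner B t xs z → FirstTouched B t z xs
first-touched {B} {t} {z} [] 1≤ = contradiction (subst (1 ≤_) (inner-[] B t z) 1≤) λ ()
first-touched {B} {t} {z} (x ∷ xs) 1≤ with deg B x (t ∷ z ∷ xs) in eq
... | suc d = at-top (subst (1 ≤_) (sym eq) (s≤s z≤n))
... | zero with deg≡0 B {x} {t ∷ z ∷ xs} eq
             | first-touched xs (subst (1 ≤_) (trans (inner-remove B t [] z) (cong (_+ inner B t xs z) eq)) 1≤)
...   | _ ∷ xz ∷ untouched | at-top d        = below [] (≤-trans d (deg-insert₃ B x)) (xz ∷ All.tail untouched)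
...   | _                  | below pre d free = below (x ∷ pre) (≤-trans d (deg-insert₃ B x)) free

below-step : ∀ {n C B t z Q} pre {u v post} → State n C B (full t (pre ++ u ∷ v ∷ post) z) Q →
             1 ≤ deg B v (t ∷ z ∷ (pre ++ u ∷ []) ++ post) → All (λ w → adj B u w ≡ false) (z ∷ post) →
             Step n C B t (pre ++ u ∷ v ∷ post) z Q
below-step {n} {C} {B} {t} {z} {Q} pre {u} {v} {post} s d (uz ∷ free) = go post refl free
  where
  loss : inner B t (pre ++ u ∷ post) z ≤ pred (inner B t (pre ++ u ∷ v ∷ post) z)
  loss = pred-mono-≤ (begin
    1 + inner B t (pre ++ u ∷ post) z           ≡⟨ cong (λ ys → 1 + inner B t ys z) (++-assoc pre (u ∷ []) post) ⟨
    1 + inner B t ((pre ++ u ∷ []) ++ post) z   ≤⟨ +-monoˡ-≤ _ d ⟩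
    deg B v (t ∷ z ∷ (pre ++ u ∷ []) ++ post) + inner B t ((pre ++ u ∷ []) ++ post) z
                                                ≡⟨ inner-remove B t (pre ++ u ∷ []) z ⟨
    inner B t ((pre ++ u ∷ []) ++ v ∷ post) z   ≡⟨ cong (λ ys → inner B t ys z) (++-assoc pre (u ∷ []) (v ∷ post)) ⟩
    inner B t (pre ++ u ∷ v ∷ post) z           ∎)
    where open ≤-Reasoning
  len : length (pre ++ u ∷ v ∷ post) ≡ suc (length (pre ++ u ∷ post))
  len = trans (cong length (sym (++-assoc pre (u ∷ []) (v ∷ post))))
        (trans (length-insert (pre ++ u ∷ [])) (cong (suc ∘ length) (++-assoc pre (u ∷ []) post)))
  go : ∀ post′ → post′ ≡ post → All (λ w → adj B u w ≡ false) post′ → Step n C B t (pre ++ u ∷ v ∷ post) z Q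
  -- The chord runs from `u` to the vertex after `v`, which is the end `z` when `v` is the last
  -- interior vertex.
  go [] refl _ = cut-step s (t ∷ pre) (cong (t ∷_) (++-assoc pre (u ∷ v ∷ []) (z ∷ [])))
                   (cong (t ∷_) (++-assoc pre (u ∷ []) (z ∷ []))) uz len loss
  go (w ∷ post′) refl (uw ∷ _) = cut-step s (t ∷ pre) (cong (t ∷_) (++-assoc pre (u ∷ v ∷ w ∷ post′) (z ∷ [])))
                   (cong (t ∷_) (++-assoc pre (u ∷ w ∷ post′) (z ∷ []))) uw len loss

drop-top₂ : ∀ {n C B t a b xs z Q} → State n C B (full t (a ∷ b ∷ xs) z) Q → State n C B (full b xs z) Q
drop-top₂ s = state (path-tail (path-tail (path s))) (reserves-L (λ ps → All.tail (All.tail ps)) (reserves s))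

-- With `b` as the new top, `a` and `b` leave the interior at a cost of 2 each, paid by four
-- B-edges. Any step on the shorter path is then a step on the whole one.
drop-step : ∀ {n C B t a b xs z Q} → 4 + inner B b xs z ≤ inner B t (a ∷ b ∷ xs) z → 1 ≤ inner B b xs z →
            Step n C B b xs z Q → Step n C B t (a ∷ b ∷ xs) z Q
drop-step {B = B} {t} {a} {b} {xs} {z} d 1≤ st = go st
  where
  -- Since `pred 0` is 0, the shorter path must keep a B-edge for the bound to pass through `pred`.
  4+pred : ∀ {i j} → 1 ≤ i → 4 + i ≤ j → 4 + pred i ≤ pred j
  4+pred {suc i} {suc j} _ le = s≤s⁻¹ le
  bound : 4 + pred (inner B b xs z) ≤ pred (inner B t (a ∷ b ∷ xs) z)
  bound = 4+pred 1≤ d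
  double : ∀ k i → 2 * (2 + k) + i ≡ 4 + (2 * k + i)
  double = solve-∀
  go : ∀ {n C Q} → Step n C B b xs z Q → Step n C B t (a ∷ b ∷ xs) z Q
  go (stop k short loss) = stop (2 + k) (≤-trans (+-monoʳ-≤ 2 short) (≤-reflexive (swap k)))
    (≤-trans (≤-reflexive (trans (sym (+-identityʳ _)) (trans (double k 0) (cong (4 +_) (+-identityʳ (2 * k))))))
      (≤-trans (+-monoʳ-≤ 4 loss) bound))
    where
    swap : ∀ k → 2 + (5 + k) ≡ 5 + (2 + k)
    swap = solve-∀
  go {n} {C} {Q} (move k l s gain loss shrink) = move (2 + k) l s
    (≤-trans (≤-reflexive (regroup (triangles n C) (length Q) 2 (length xs))) (+-monoʳ-≤ 2 gain))
    (≤-trans (≤-reflexive (double k _)) (≤-trans (+-monoʳ-≤ 4 loss) bound))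
    (≤-trans shrink (m≤n+m _ 2))

-- Paths with at least six interior vertices.

module _ {n C B t a₁ a₂ a₃ a₄ a₅ a₆ r z Q} (s : State n C B (full t (a₁ ∷ a₂ ∷ a₃ ∷ a₄ ∷ a₅ ∷ a₆ ∷ r) z) Q) where

  private
    xs : List ℕ
    xs = a₁ ∷ a₂ ∷ a₃ ∷ a₄ ∷ a₅ ∷ a₆ ∷ r

  -- t and a₁ carry so many B-edges that forgetting them costs nothing.
  Droppable : Set
  Droppable = 4 + inner B a₂ (a₃ ∷ a₄ ∷ a₅ ∷ a₆ ∷ r) z ≤ inner B t xs z × adj B a₂ a₄ ≡ true

  module _ (e₀₂ : adj B t  a₂ ≡ true) (e₁₃ : adj B a₁ a₃ ≡ true) (e₂₄ : adj B a₂ a₄ ≡ true)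
           (e₃₅ : adj B a₃ a₅ ≡ true) (e₄₆ : adj B a₄ a₆ ≡ true) where

    private
      e₂₀ = flip-adj t a₂ e₀₂
      e₃₁ = flip-adj a₁ a₃ e₁₃
      e₄₂ = flip-adj a₂ a₄ e₂₄

    private
      skip₂₃ : ∀ {k l} → adj B a₁ a₄ ≡ false → Hits B a₂ k (t ∷ z ∷ a₁ ∷ a₃ ∷ a₄ ∷ a₅ ∷ a₆ ∷ r) →
               Hits B a₃ l (t ∷ z ∷ a₁ ∷ a₄ ∷ a₅ ∷ a₆ ∷ r) → 5 ≤ k + l → Step n C B t xs z Q
      skip₂₃ {k} {l} f₁₄ h₂ h₃ 5≤ = splice-step s (t ∷ []) (a₃ ∷ []) 1 refl refl f₁₄ refl
        (≤-trans (+-monoˡ-≤ _ 5≤) (≤-trans (≤-reflexive (+-assoc k l _)) (remove₂ (a₁ ∷ []) h₂ h₃)))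

    -- All ears at `a₁`, ..., `a₅` are blocked, so each of these vertices carries B-edges. The
    -- longer chords decide: a jump over two vertices must shed 5 B-edges, a jump over three 7, a
    -- pentagon 5.
    blocked-ears-step : Step n C B t xs z Q ⊎ Droppable
    blocked-ears-step with true-or-false (adj B a₁ a₄) | true-or-false (adj B a₂ a₅) | true-or-false (adj B a₁ a₅)
    ... | inj₁ e₁₄ | inj₂ e₂₅ | _ = inj₁ (splice-step s (t ∷ a₁ ∷ []) (a₄ ∷ []) 1 refl refl e₂₅ refl
            (remove₂ (a₁ ∷ a₂ ∷ [])
              (─ ─ e₃₁ ✓ ─ ─ e₃₅ ✓ none)
              (─ ─ flip-adj a₁ a₄ e₁₄ ✓ e₄₂ ✓ ─ e₄₆ ✓ none)))
    ... | inj₁ e₁₄ | inj₁ e₂₅ | inj₂ e₁₅ = inj₁ (splice-step s (t ∷ []) (a₃ ∷ a₄ ∷ []) 2 refl refl e₁₅ refl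
            (remove₃ (a₁ ∷ [])
              (e₂₀ ✓ ─ ─ ─ e₂₄ ✓ e₂₅ ✓ none)
              (─ ─ e₃₁ ✓ ─ e₃₅ ✓ none)
              (─ ─ flip-adj a₁ a₄ e₁₄ ✓ ─ e₄₆ ✓ none)))
    -- Three B-edges leave with `a₁` and the edge `t a₂` with `t`: the four needed for dropping the
    -- top.
    ... | inj₁ e₁₄ | inj₁ e₂₅ | inj₁ e₁₅ = inj₂ (≤-trans (+-monoʳ-≤ 3 drop-t) (remove₁ [] {a₁} (─ ─ ─ e₁₃ ✓ e₁₄ ✓ e₁₅ ✓ none)) , e₂₄)
      where
      drop-t : 1 + inner B a₂ (a₃ ∷ a₄ ∷ a₅ ∷ a₆ ∷ r) z ≤ inner B t (a₂ ∷ a₃ ∷ a₄ ∷ a₅ ∷ a₆ ∷ r) z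
      drop-t = inner-pop B e₀₂
    ... | inj₂ e₁₄ | inj₁ e₂₅ | _ = inj₁ (skip₂₃ e₁₄ (e₂₀ ✓ ─ ─ ─ e₂₄ ✓ e₂₅ ✓ none) (─ ─ e₃₁ ✓ ─ e₃₅ ✓ none) ≤-refl)
    ... | inj₂ e₁₄ | inj₂ e₂₅ | inj₂ e₁₅ = inj₁ (pentagon-step s (t ∷ []) refl refl e₁₅ e₂₅ e₁₄ refl
            (remove₃ (a₁ ∷ []) (e₂₀ ✓ ─ ─ ─ e₂₄ ✓ none) (─ ─ e₃₁ ✓ ─ e₃₅ ✓ none) (─ ─ ─ ─ e₄₆ ✓ none)))
    -- The pentagon on `a₁`, ..., `a₅` lacks its closing chord. A B-edge from `a₆` to `a₂` or `a₃`
    -- is the fifth for the jump over `a₂` and `a₃`; without one, the pentagon on `a₂`, ..., `a₆` is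
    -- available.
    ... | inj₂ e₁₄ | inj₂ e₂₅ | inj₁ e₁₅ with true-or-false (adj B a₃ a₆) | true-or-false (adj B a₂ a₆)
    ...   | inj₁ e₃₆ | _ = inj₁ (skip₂₃ e₁₄ (e₂₀ ✓ ─ ─ ─ e₂₄ ✓ none) (─ ─ e₃₁ ✓ ─ e₃₅ ✓ e₃₆ ✓ none) ≤-refl)
    ...   | inj₂ e₃₆ | inj₁ e₂₆ = inj₁ (skip₂₃ e₁₄ (e₂₀ ✓ ─ ─ ─ e₂₄ ✓ ─ e₂₆ ✓ none) (─ ─ e₃₁ ✓ ─ e₃₅ ✓ none) ≤-refl)
    ...   | inj₂ e₃₆ | inj₂ e₂₆ = inj₁ (pentagon-step s (t ∷ a₁ ∷ []) refl refl e₂₆ e₃₆ e₂₅ refl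
            (remove₃ (a₁ ∷ a₂ ∷ [])
              (─ ─ e₃₁ ✓ ─ ─ e₃₅ ✓ none)
              (─ ─ ─ e₄₂ ✓ ─ e₄₆ ✓ none)
              (─ ─ flip-adj a₁ a₅ e₁₅ ✓ none)))

  -- A free ear next to a blocked one (or next to a vertex with a B-edge) can be cut at a profit.
  first-ears-step : 1 ≤ deg B a₁ (t ∷ z ∷ a₂ ∷ a₃ ∷ a₄ ∷ a₅ ∷ a₆ ∷ r) → Step n C B t xs z Q ⊎ Droppable
  first-ears-step 1≤ with true-or-false (adj B t a₂) | true-or-false (adj B a₁ a₃) | true-or-false (adj B a₂ a₄) | true-or-false (adj B a₃ a₅) | true-or-false (adj B a₄ a₆)
  ... | inj₂ e₀₂ | _ | _ | _ | _ = inj₁ (cut-step s [] refl refl e₀₂ refl (pred-mono-≤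
          (≤-trans (+-monoˡ-≤ _ 1≤) (≤-reflexive (sym (inner-remove B t [] z))))))
  ... | inj₁ e₀₂ | inj₂ e₁₃ | _ | _ | _ = inj₁ (cut-step s (t ∷ []) refl refl e₁₃ refl (pred-mono-≤
          (remove₁ (a₁ ∷ []) (flip-adj t a₂ e₀₂ ✓ none))))
  ... | inj₁ e₀₂ | inj₁ e₁₃ | inj₂ e₂₄ | _ | _ = inj₁ (cut-step s (t ∷ a₁ ∷ []) refl refl e₂₄ refl (pred-mono-≤
          (remove₁ (a₁ ∷ a₂ ∷ []) (─ ─ flip-adj a₁ a₃ e₁₃ ✓ none))))
  ... | inj₁ e₀₂ | inj₁ e₁₃ | inj₁ e₂₄ | inj₂ e₃₅ | _ = inj₁ (cut-step s (t ∷ a₁ ∷ a₂ ∷ []) refl refl e₃₅ refl (pred-mono-≤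
          (remove₁ (a₁ ∷ a₂ ∷ a₃ ∷ []) (─ ─ ─ flip-adj a₂ a₄ e₂₄ ✓ none))))
  ... | inj₁ e₀₂ | inj₁ e₁₃ | inj₁ e₂₄ | inj₁ e₃₅ | inj₂ e₄₆ = inj₁ (cut-step s (t ∷ a₁ ∷ a₂ ∷ a₃ ∷ []) refl refl e₄₆ refl (pred-mono-≤
          (remove₁ (a₁ ∷ a₂ ∷ a₃ ∷ a₄ ∷ []) (─ ─ ─ ─ flip-adj a₃ a₅ e₃₅ ✓ none))))
  ... | inj₁ e₀₂ | inj₁ e₁₃ | inj₁ e₂₄ | inj₁ e₃₅ | inj₁ e₄₆ = blocked-ears-step e₀₂ e₁₃ e₂₄ e₃₅ e₄₆

  long-step : Step n C B t xs z Q ⊎ Droppable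
  long-step = by-inner (inner B t xs z) refl
    where
    touched : ∀ {ys} → FirstTouched B t z ys → ys ≡ xs → Step n C B t xs z Q ⊎ Droppable
    touched (below pre d free) eq = inj₁ (subst (λ ys → Step n C B t ys z Q) eq
      (below-step pre (subst (λ ys → State n C B (full t ys z) Q) (sym eq) s) d free))
    touched (at-top d) refl = first-ears-step d
    by-inner : ∀ i → inner B t xs z ≡ i → Step n C B t xs z Q ⊎ Droppable
    -- Without counted B-edges the first ear is free, and as `pred 0` is 0 nothing has to be won
    -- back.
    by-inner zero eq = inj₁ (cut-step s [] refl refl clear refl (subst (inner B t (a₂ ∷ a₃ ∷ a₄ ∷ a₅ ∷ a₆ ∷ r) z ≤_) (sym (cong pred eq))
      (subst (inner B t (a₂ ∷ a₃ ∷ a₄ ∷ a₅ ∷ a₆ ∷ r) z ≤_) eq (≤-trans (m≤n+m _ _) (≤-reflexive (sym (inner-remove B t [] z)))))))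
      where
      clear : adj B t a₂ ≡ false
      clear = All.head (All.tail (deg≡0 B (n≤0⇒n≡0 (subst (deg B t xs ≤_) eq (deg≤inner B t xs z)))))
    by-inner (suc i) eq = touched (first-touched xs (subst (1 ≤_) (sym eq) (s≤s z≤n))) refl

-- The argument is the step for the path starting at `b`, handed in so that `step` recurses
-- structurally. At most five interior vertices mean a stop.
step₂ : ∀ {n C B t a b z Q} xs → (State n C B (full b xs z) Q → Step n C B b xs z Q) →
        State n C B (full t (a ∷ b ∷ xs) z) Q → Step n C B t (a ∷ b ∷ xs) z Q
step₂ []               _   s = stop 0 (m≤m+n 2 3) z≤n
step₂ (_ ∷ [])         _   s = stop 0 (m≤m+n 3 2) z≤n
step₂ (_ ∷ _ ∷ [])     _   s = stop 0 (m≤m+n 4 1) z≤n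
step₂ (_ ∷ _ ∷ _ ∷ []) _   s = stop 0 ≤-refl z≤n
step₂ {B = B} {b = b} {z} xs@(_ ∷ _ ∷ _ ∷ _ ∷ r) rec s with long-step s
... | inj₁ st        = st
... | inj₂ (d , e₂₄) = drop-step d (≤-trans (hits-deg (─ e₂₄ ✓ none)) (deg≤inner B b xs z)) (rec (drop-top₂ {xs = xs} s))

step : ∀ {n C B t z Q} xs → State n C B (full t xs z) Q → Step n C B t xs z Q
step []           s = stop 0 z≤n z≤n
step (_ ∷ [])     s = stop 0 (m≤m+n 1 4) z≤n
step (_ ∷ _ ∷ xs) s = step₂ xs (step xs) s

-- Playing out the reserved pairs and the finished path.

double-suc : ∀ m → 2 * suc m ≡ suc (suc (2 * m))
double-suc m = *-suc 2 m

module _ {n v : ℕ} where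

  -- The path is given up. Constructor takes an edge of a pair on her turn, or the partner if
  -- Blocker has just taken one, so every pair yields a triangle within two moves.
  cash-constructor : ∀ f {C B Q} → Reserves n C B [] Q → 2 * length Q ≤ f → v ≤ triangles n C + length Q → v ≤ value n f true C B
  cash-blocker : ∀ f {C B Q} → Reserves n C B [] Q → suc (2 * length Q) ≤ f → v ≤ triangles n C + length Q → v ≤ value n f false C B

  cash-constructor f {C} {B} {[]} r _ v≤ = ≤-trans v≤ (≤-trans (≤-reflexive (+-identityʳ _)) (triangles≤value n f true C B))
  cash-constructor zero {Q = _ ∷ Q} r fuel _ = contradiction (subst (_≤ 0) (double-suc (length Q)) fuel) λ ()
  cash-constructor (suc f) {C} {B} {(g , _) ∷ Q} r fuel v≤ = constructor-move-≥ n f C B (playable rg)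
    (cash-blocker f (reserves-cash [] r (inj₁ refl)) (s≤s⁻¹ (subst (_≤ suc f) (double-suc (length Q)) fuel))
      (≤-trans v≤ (≤-trans (≤-reflexive (+-suc _ _)) (+-monoˡ-≤ _ (triangles-completes (∉C (free (playable rg))) (scoring rg))))))
    where rg = All.head (ready r) g (inj₁ refl)

  cash-blocker (suc f) {C} {B} {Q} r fuel v≤ = blocker-moves-≥ n f C B (cash-constructor (suc f) r (<⇒≤ fuel) v≤) reply
    where
    reply : ∀ {e} → Unclaimed n C B e → v ≤ value n f true C (e ∷ B)
    reply {e} _ with react r e
    ... | intact r′ = cash-constructor f r′ (s≤s⁻¹ fuel) v≤
    ... | answer {g} {Q′} _ len rg r′ = answered f (subst (λ l → suc (2 * l) ≤ suc f) len fuel)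
      where
      answered : ∀ f → suc (2 * suc (length Q′)) ≤ suc f → v ≤ value n f true C (e ∷ B)
      answered zero    (s≤s fuel) = contradiction (subst (_≤ 0) (double-suc (length Q′)) fuel) λ ()
      answered (suc f) (s≤s fuel) = constructor-move-≥ n f C (e ∷ B) (playable rg)
        (cash-blocker f r′ (s≤s⁻¹ (subst (_≤ suc f) (double-suc (length Q′)) fuel))
          (≤-trans v≤ (≤-trans (≤-reflexive (trans (cong (triangles n C +_) len) (+-suc _ _)))
            (+-monoˡ-≤ _ (triangles-completes (∉C (free (playable rg))) (scoring rg))))))

  path-unique : ∀ {C t xs z} → Path n C (full t xs z) → Unique (z ∷ t ∷ xs)
  path-unique {xs = xs} p = rotate (descending p)
    where
    last-fresh : ∀ ys {z} → AllPairs _>_ (ys ++ z ∷ []) → All (z ≢_) ys × Unique ys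
    last-fresh []       _        = [] , []
    last-fresh (y ∷ ys) (y> ∷ d) with last-fresh ys d | All.++⁻ ys y>
    ... | z≢ , u | y>ys , z<y ∷ [] = <⇒≢ z<y ∷ z≢ , All.map (≢-sym ∘ <⇒≢) y>ys ∷ u
    rotate : ∀ {t z} → AllPairs _>_ (full t xs z) → Unique (z ∷ t ∷ xs)
    rotate {t} d with last-fresh (t ∷ xs) d
    ... | z≢ , u = z≢ ∷ u

  rotate-All : ∀ {P : ℕ → Set} {t xs z} → All P (full t xs z) → All P (z ∷ t ∷ xs)
  rotate-All {xs = xs} (pt ∷ ps) with All.++⁻ xs ps
  ... | pxs , pz ∷ [] = pz ∷ pt ∷ pxs

  -- The 10 pays for the up to five interior vertices of a path that is given up.
  path-constructor : ∀ f {C B t xs z Q} → State n C B (full t xs z) Q → 2 * (length xs + length Q) ≤ f →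
           10 + 2 * v + pred (inner B t xs z) ≤ 2 * (triangles n C + (length Q + length xs)) → v ≤ value n f true C B
  path-blocker : ∀ f {C B t xs z Q} → State n C B (full t xs z) Q → suc (2 * (length xs + length Q)) ≤ f →
           10 + 2 * v + inner B t xs z ≤ 2 * (triangles n C + (length Q + length xs)) → v ≤ value n f false C B

  path-constructor f {C} {B} {t} {xs} {z} {Q} s fuel budget with step xs s
  ... | stop k short drop = cash-constructor f (reserves-L (λ _ → []) (reserves s))
        (≤-trans (*-monoʳ-≤ 2 (m≤n+m (length Q) (length xs))) fuel)
        (*-cancelˡ-≤ 2 (+-cancelˡ-≤ (10 + 2 * k) _ _ (begin
          10 + 2 * k + 2 * v                                    ≡⟨ swap k v ⟩
          10 + 2 * v + 2 * k                                    ≤⟨ +-monoʳ-≤ (10 + 2 * v) drop ⟩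
          10 + 2 * v + pred (inner B t xs z)                    ≤⟨ budget ⟩
          2 * (triangles n C + (length Q + length xs))          ≤⟨ *-monoʳ-≤ 2 (+-monoʳ-≤ (triangles n C) (+-monoʳ-≤ (length Q) short)) ⟩
          2 * (triangles n C + (length Q + (5 + k)))            ≡⟨ collect (triangles n C) (length Q) k ⟩
          10 + 2 * k + 2 * (triangles n C + length Q)           ∎)))
    where
    open ≤-Reasoning
    swap : ∀ k v → 10 + 2 * k + 2 * v ≡ 10 + 2 * v + 2 * k
    swap = solve-∀
    collect : ∀ T q k → 2 * (T + (q + (5 + k))) ≡ 10 + 2 * k + 2 * (T + q)
    collect = solve-∀
  ... | move k {t′} {xs′} {Q′} {e} l s′ gain loss shrink = played f (≤-trans (*-monoʳ-≤ 2 shrink) fuel)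
    where
    open ≤-Reasoning
    swap : ∀ k v i → 2 * k + (10 + 2 * v + i) ≡ 10 + 2 * v + (2 * k + i)
    swap = solve-∀
    budget′ : 10 + 2 * v + inner B t′ xs′ z ≤ 2 * (triangles n (e ∷ C) + (length Q′ + length xs′))
    budget′ = +-cancelˡ-≤ (2 * k) _ _ (begin
      2 * k + (10 + 2 * v + inner B t′ xs′ z)        ≡⟨ swap k v _ ⟩
      10 + 2 * v + (2 * k + inner B t′ xs′ z)        ≤⟨ +-monoʳ-≤ (10 + 2 * v) loss ⟩
      10 + 2 * v + pred (inner B t xs z)             ≤⟨ budget ⟩
      2 * (triangles n C + (length Q + length xs))   ≤⟨ *-monoʳ-≤ 2 gain ⟩
      2 * (k + (triangles n (e ∷ C) + (length Q′ + length xs′)))     ≡⟨ *-distribˡ-+ 2 k _ ⟩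
      2 * k + 2 * (triangles n (e ∷ C) + (length Q′ + length xs′))   ∎)
    played : ∀ f → 2 * suc (length xs′ + length Q′) ≤ f → v ≤ value n f true C B
    played zero    fuel = contradiction (subst (_≤ 0) (double-suc _) fuel) λ ()
    played (suc f) fuel = constructor-move-≥ n f C B l
      (path-blocker f s′ (s≤s⁻¹ (subst (_≤ suc f) (double-suc _) fuel)) budget′)

  path-blocker (suc f) {C} {B} {t} {xs} {z} {Q} s fuel budget =
    blocker-moves-≥ n f C B (path-constructor (suc f) s (<⇒≤ fuel) (≤-trans (+-monoʳ-≤ (10 + 2 * v) pred[n]≤n) budget)) reply
    where
    reply : ∀ {e} → Unclaimed n C B e → v ≤ value n f true C (e ∷ B)
    reply {e} _ with react (reserves s) e
    -- Blocker's edge raises the count by at most one, which `pred` takes off again.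
    ... | intact r′ = path-constructor f (state (path s) r′) (s≤s⁻¹ fuel)
          (≤-trans (+-monoʳ-≤ (10 + 2 * v) (pred-mono-≤ (inner-add e B (path-unique (path s))))) budget)
    -- His edge is not counted, and Constructor's triangle replaces the used pair, so the budget is
    -- as before and Blocker is to move again.
    ... | answer {g} {Q′} off len rg r′ = answered f (subst (λ l → suc (2 * (length xs + l)) ≤ suc f) len fuel)
      where
      open ≤-Reasoning
      off′ : All (_≢ proj₁ e) (z ∷ t ∷ xs) ⊎ All (_≢ proj₂ e) (z ∷ t ∷ xs)
      off′ = case off of λ where
        (inj₁ o) → inj₁ (rotate-All o)
        (inj₂ o) → inj₂ (rotate-All o)
      budget′ : 10 + 2 * v + inner (e ∷ B) t xs z ≤ 2 * (triangles n (g ∷ C) + (length Q′ + length xs))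
      budget′ = begin
        10 + 2 * v + inner (e ∷ B) t xs z                     ≤⟨ +-monoʳ-≤ (10 + 2 * v) (inner-off e B off′) ⟩
        10 + 2 * v + inner B t xs z                           ≤⟨ budget ⟩
        2 * (triangles n C + (length Q + length xs))          ≡⟨ cong (λ l → 2 * (triangles n C + (l + length xs))) len ⟩
        2 * (triangles n C + suc (length Q′ + length xs))     ≡⟨ cong (2 *_) (+-suc (triangles n C) (length Q′ + length xs)) ⟩
        2 * (suc (triangles n C) + (length Q′ + length xs))   ≤⟨ *-monoʳ-≤ 2 (+-monoˡ-≤ _ (triangles-completes (∉C (free (playable rg))) (scoring rg))) ⟩
        2 * (triangles n (g ∷ C) + (length Q′ + length xs))   ∎
      answered : ∀ f → suc (2 * (length xs + suc (length Q′))) ≤ suc f → v ≤ value n f true C (e ∷ B)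
      answered f (s≤s fuel) with subst (_≤ f) (trans (cong (2 *_) (+-suc (length xs) (length Q′))) (double-suc _)) fuel
      answered (suc f) (s≤s fuel) | s≤s fuel′ = constructor-move-≥ n f C (e ∷ B) (playable rg)
        (path-blocker f (state (path-grow g (path s) (shielding rg)) r′) fuel′ budget′)

  -- Building the path upwards through the vertices `F` still to come.

  record Growing (C B : List Edge) (t : ℕ) (xs : List ℕ) (z : ℕ) (F : List ℕ) : Set where
    field
      grown     : Path n C (full t xs z)
      ascending : AllPairs _<_ (t ∷ F)
      in-range  : All (_< n) F
      untouched : All (λ q → ∀ {h} → h ∈ C → proj₂ h < q) F
      isolated  : All (Isolated B) F
      sorted    : ∀ {e} → e ∈ B → proj₁ e < proj₂ e
  open Growing

  path≤top : ∀ {C t xs z} → Path n C (full t xs z) → All (_≤ t) (full t xs z)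
  path≤top p with descending p
  ... | t> ∷ _ = ≤-refl ∷ All.map <⇒≤ t>

  -- All edges of `C` end below `q`, so one crossing `tq` would have `t` strictly below it. Blocker
  -- does not own `tq`, as `q` is not the larger end of a B-edge.
  extend-legal : ∀ {C B t xs z q F} → Growing C B t xs z (q ∷ F) → Legal n C B (t , q)
  extend-legal g with ascending g | in-range g | untouched g | isolated g | uncovered (grown g)
  ... | (t<q ∷ _) ∷ _ | q<n ∷ _ | new ∷ _ | iso ∷ _ | unc ∷ _ = legal
    (unclaimed-edge t<q q<n (λ tq∈ → <-irrefl refl (new tq∈)) (λ tq∈ → iso tq∈ refl))
    λ where
      h∈ (inj₁ (_ , _ , q<d))   → <-asym q<d (new h∈)
      h∈ (inj₂ (c<t , t<d , _)) → unc h∈ (c<t , t<d)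

  extend : ∀ {C B t xs z q F} → Growing C B t xs z (q ∷ F) → Growing ((t , q) ∷ C) B q (t ∷ xs) z F
  extend {C} {t = t} {q = q} g with ascending g | in-range g | untouched g | isolated g | path≤top (grown g)
  ... | (t<q ∷ _) ∷ q<F ∷ F< | q<n ∷ F<n | new ∷ news | _ ∷ isos | ≤t = record
    { grown = record
      { descending = All.map (λ p≤t → ≤-<-trans p≤t t<q) ≤t ∷ descending (grown g)
      ; bounded-by = q<n ∷ bounded-by (grown g)
      ; linked     = here refl ∷ Linked.map there (linked (grown g))
      ; uncovered  = (λ { (here refl) (_ , q<q) → <-irrefl refl q<q ; (there h∈) (_ , q<d) → <-asym q<d (new h∈) })
                   ∷ All.zipWith (λ { (unc , p≤t) (here refl) (t<p , _) → <⇒≱ t<p p≤t ; (unc , p≤t) (there h∈) → unc h∈ })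
                       (uncovered (grown g) , ≤t)
      }
    ; ascending = q<F ∷ F<
    ; in-range  = F<n
    ; untouched = All.zipWith (λ { (q<q′ , _) (here refl) → q<q′ ; (_ , new′) (there h∈) → new′ h∈ }) (q<F , news)
    ; isolated  = isos
    ; sorted    = sorted g
    }

  -- All path vertices are smaller than `q`, and `q` has no B-edge downwards.
  extend-inside : ∀ {C B t xs z q F} → Growing C B t xs z (q ∷ F) → inside B (z ∷ q ∷ t ∷ xs) ≡ inside B (z ∷ t ∷ xs)
  extend-inside {B = B} {t} {xs} {z} {q} g with ascending g | isolated g
  ... | (t<q ∷ _) ∷ _ | iso ∷ _ = trans (inside-remove B (z ∷ []))
    (cong (_+ inside B (z ∷ t ∷ xs))
      (deg-isolated B iso (sorted g) (All.map (λ p≤t → ≤-<-trans p≤t t<q) (rotate-All (path≤top (grown g))))))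

  blocked : ∀ {C B t xs z F} e → proj₁ e < proj₂ e → Growing C B t xs z F → Growing C (e ∷ B) t xs z (without (proj₂ e) F)
  blocked e e< g with ascending g
  ... | t< ∷ F< = record
    { grown     = grown g
    ; ascending = All.map proj₂ (All-without (proj₂ e) t<) ∷ AllPairs-without (proj₂ e) F<
    ; in-range  = All.map proj₂ (All-without (proj₂ e) (in-range g))
    ; untouched = All.map proj₂ (All-without (proj₂ e) (untouched g))
    ; isolated  = All.map (λ { (q≢ , iso) (here refl) → ≢-sym q≢ ; (_ , iso) (there h∈) → iso h∈ })
                    (All-without (proj₂ e) (isolated g))
    ; sorted    = λ { (here refl) → e< ; (there h∈) → sorted g h∈ }
    }

  -- Blocker's edge either strikes its larger end off `F`, and then does not lie inside the path, or
  -- leaves `F` alone and adds at most one inside. It costs him a move for at most 1.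
  blocked-budget : ∀ {C B t xs z F} e → Growing C B t xs z F →
                   inside (e ∷ B) (z ∷ t ∷ xs) + length F ≤ suc (inside B (z ∷ t ∷ xs) + length (without (proj₂ e) F))
  blocked-budget {B = B} {t} {xs} {z} {F} e g with ascending g | mem? _≟_ (proj₂ e) F
  ... | t< ∷ F< | yes q∈ = ≤-trans
    (+-mono-≤ (≤-reflexive (inside-new e B (inj₂ refl) (All.map (λ p≤t → <⇒≢ (≤-<-trans p≤t (All.lookup t< q∈))) (rotate-All (path≤top (grown g))))))
              (length-without (proj₂ e) F<))
    (≤-reflexive (+-suc _ _))
  ... | _ | no q∉ = +-mono-≤ (inside-add e B (path-unique (grown g)))
    (≤-reflexive (cong length (sym (filter-all (λ u → ¬? (u ≟ proj₂ e)) (All.map (≢-sym) (All.¬Any⇒All¬ F q∉))))))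

  -- Extending the path turns a vertex to come, worth 1, into one more interior vertex, worth 2;
  -- this gain of 1 meets Blocker's 1. The fuel allows a vertex of `F` two moves now and two once it
  -- is interior.
  grow-constructor : ∀ f {C B t xs z F} → Growing C B t xs z F → 2 * (2 * length F + length xs) ≤ f →
           10 + 2 * v + inside B (z ∷ t ∷ xs) ≤ 2 * length xs + length F → v ≤ value n f true C B
  grow-blocker : ∀ f {C B t xs z F} → Growing C B t xs z F → suc (2 * (2 * length F + length xs)) ≤ f →
           11 + 2 * v + inside B (z ∷ t ∷ xs) ≤ 2 * length xs + length F → v ≤ value n f false C B

  grow-constructor f {C} {B} {t} {xs} {z} {[]} g fuel budget = path-constructor f (state (grown g) reserves-[])
    (subst (λ l → 2 * l ≤ f) (sym (+-identityʳ (length xs))) fuel)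
    (begin
      10 + 2 * v + pred (inner B t xs z)             ≤⟨ +-monoʳ-≤ (10 + 2 * v) (≤-trans (pred[n]≤n {inner B t xs z}) (m≤n+m (inner B t xs z) (bit (adj B z t)))) ⟩
      10 + 2 * v + (bit (adj B z t) + inner B t xs z) ≡⟨ cong (10 + 2 * v +_) (inside≡inner B t xs z) ⟨
      10 + 2 * v + inside B (z ∷ t ∷ xs)             ≤⟨ budget ⟩
      2 * length xs + 0                              ≡⟨ +-identityʳ _ ⟩
      2 * length xs                                  ≤⟨ *-monoʳ-≤ 2 (m≤n+m (length xs) (triangles n C)) ⟩
      2 * (triangles n C + length xs)                ∎)
    where open ≤-Reasoning
  grow-constructor f {C} {B} {t} {xs} {z} {q ∷ F} g fuel budget = extended f (subst (_≤ f) (fuel-shape (length F) (length xs)) fuel)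
    where
    open ≤-Reasoning
    fuel-shape : ∀ k l → 2 * (2 * suc k + l) ≡ 2 + suc (suc (2 * (2 * k + l)))
    fuel-shape = solve-∀
    fuel-shape′ : ∀ k l → suc (2 * (2 * k + suc l)) ≡ suc (suc (suc (2 * (2 * k + l))))
    fuel-shape′ = solve-∀
    budget-shape : ∀ k l → suc (2 * l + suc k) ≡ 2 * suc l + k
    budget-shape = solve-∀
    budget′ : 11 + 2 * v + inside B (z ∷ q ∷ t ∷ xs) ≤ 2 * suc (length xs) + length F
    budget′ = begin
      11 + 2 * v + inside B (z ∷ q ∷ t ∷ xs)  ≡⟨ cong (11 + 2 * v +_) (extend-inside g) ⟩
      11 + 2 * v + inside B (z ∷ t ∷ xs)      ≤⟨ s≤s budget ⟩
      suc (2 * length xs + suc (length F))    ≡⟨ budget-shape (length F) (length xs) ⟩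
      2 * suc (length xs) + length F          ∎
    extended : ∀ f → 2 + suc (suc (2 * (2 * length F + length xs))) ≤ f → v ≤ value n f true C B
    extended (suc f) (s≤s fuel) = constructor-move-≥ n f C B (extend-legal g)
      (grow-blocker f (extend g) (subst (_≤ f) (sym (fuel-shape′ (length F) (length xs))) fuel) budget′)

  grow-blocker (suc f) {C} {B} {t} {xs} {z} {F} g fuel budget =
    blocker-moves-≥ n f C B (grow-constructor (suc f) g (<⇒≤ fuel) (<⇒≤ budget)) reply
    where
    open ≤-Reasoning
    reply : ∀ {e} → Unclaimed n C B e → v ≤ value n f true C (e ∷ B)
    reply {e} u = grow-constructor f (blocked e (ordered u) g)
      (≤-trans (*-monoʳ-≤ 2 (+-monoˡ-≤ (length xs) (*-monoʳ-≤ 2 (without-length (proj₂ e) F)))) (s≤s⁻¹ fuel))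
      (+-cancelʳ-≤ (suc (inside B (z ∷ t ∷ xs) + length F)) _ _ (begin
        (10 + 2 * v + i′) + suc (i + length F)                ≡⟨ swap₁ v i′ i (length F) ⟩
        (11 + 2 * v + i) + (i′ + length F)                    ≤⟨ +-mono-≤ budget (blocked-budget e g) ⟩
        (2 * length xs + length F) + suc (i + length F′)      ≡⟨ swap₂ (length xs) (length F) i (length F′) ⟩
        (2 * length xs + length F′) + suc (i + length F)      ∎))
      where
      F′ = without (proj₂ e) F
      i = inside B (z ∷ t ∷ xs)
      i′ = inside (e ∷ B) (z ∷ t ∷ xs)
      swap₁ : ∀ v i′ i k → (10 + 2 * v + i′) + suc (i + k) ≡ (11 + 2 * v + i) + (i′ + k)
      swap₁ = solve-∀
      swap₂ : ∀ l k i k′ → (2 * l + k) + suc (i + k′) ≡ (2 * l + k′) + suc (i + k)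
      swap₂ = solve-∀

  first-growing : 2 ≤ n → Growing ((0 , 1) ∷ []) [] 1 [] 0 (applyUpTo (2 +_) (n ∸ 2))
  first-growing 2≤n = record
    { grown = record
      { descending = (≤-refl ∷ []) ∷ [] ∷ []
      ; bounded-by = 2≤n ∷ <-trans ≤-refl 2≤n ∷ []
      ; linked     = here refl ∷ [-]
      ; uncovered  = (λ { (here refl) (_ , s≤s ()) }) ∷ (λ { (here refl) (() , _) }) ∷ []
      }
    ; ascending = All.applyUpTo⁺₂ (2 +_) (n ∸ 2) (λ _ → s≤s (s≤s z≤n))
                ∷ AllPairs.applyUpTo⁺₁ (2 +_) (n ∸ 2) (λ i<j _ → s≤s (s≤s i<j))
    ; in-range  = All.applyUpTo⁺₁ (2 +_) (n ∸ 2) (λ i<n∸2 → <-≤-trans (s≤s (s≤s i<n∸2)) (≤-reflexive (m+[n∸m]≡n 2≤n)))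
    ; untouched = All.applyUpTo⁺₂ (2 +_) (n ∸ 2) (λ { _ (here refl) → s≤s (s≤s z≤n) })
    ; isolated  = All.applyUpTo⁺₂ (2 +_) (n ∸ 2) (λ _ ())
    ; sorted    = λ ()
    }

  -- Constructor opens with the edge 01. The 13 is the 11 of `grow-blocker` plus the vertices 0 and
  -- 1, which are ends of the path and count nothing.
  value-≥ : ∀ f → 2 ≤ n → 4 * n ≤ f → 13 + 2 * v ≤ n → v ≤ value n f true [] []
  value-≥ zero    2≤n fuel _ = contradiction (≤-trans (*-monoʳ-≤ 4 2≤n) fuel) λ ()
  value-≥ (suc f) 2≤n fuel v≤ = constructor-move-≥ n f [] []
    (legal (unclaimed-edge ≤-refl 2≤n (λ ()) (λ ())) (λ ()))
    (grow-blocker f (first-growing 2≤n)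
      (subst (λ l → suc (2 * (2 * l + 0)) ≤ f) (sym (length-applyUpTo (2 +_) (n ∸ 2))) enough)
      (begin
        11 + 2 * v + inside [] (0 ∷ 1 ∷ [])  ≡⟨ cong (11 + 2 * v +_) (inside-[] (0 ∷ 1 ∷ [])) ⟩
        11 + 2 * v + 0                       ≡⟨ +-identityʳ _ ⟩
        11 + 2 * v                           ≤⟨ ∸-monoˡ-≤ 2 v≤ ⟩
        n ∸ 2                                ≡⟨ length-applyUpTo (2 +_) (n ∸ 2) ⟨
        length (applyUpTo (2 +_) (n ∸ 2))    ∎))
    where
    open ≤-Reasoning
    shape : ∀ m → suc (suc (2 * (2 * m + 0))) + 6 ≡ 4 * (2 + m)
    shape = solve-∀
    enough : suc (2 * (2 * (n ∸ 2) + 0)) ≤ f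
    enough = s≤s⁻¹ (begin
      suc (suc (2 * (2 * (n ∸ 2) + 0)))      ≤⟨ m≤m+n _ 6 ⟩
      suc (suc (2 * (2 * (n ∸ 2) + 0))) + 6  ≡⟨ shape (n ∸ 2) ⟩
      4 * (2 + (n ∸ 2))                      ≡⟨ cong (4 *_) (m+[n∸m]≡n 2≤n) ⟩
      4 * n                                  ≤⟨ fuel ⟩
      suc f                                  ∎)

-- The lower bound and the asymptotic statement.

gECB-lower : ∀ {n} → 9 ≤ n → n ≤ 14 + 2 * gECB n
-- Otherwise the strategy would secure one triangle more than the value of the game.
gECB-lower {n} 9≤n = ≮⇒≥ λ lt → <-irrefl refl
  (value-≥ {n} {suc (gECB n)} (length (edges n)) (≤-trans (m≤m+n 2 7) 9≤n) (4*n≤length-edges 9≤n)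
    (≤-trans (≤-reflexive (shape (gECB n))) lt))
  where
  shape : ∀ g → 13 + 2 * suc g ≡ suc (14 + 2 * g)
  shape = solve-∀

-- The factors `1 + o(1)` are rendered as `1 - 1/k` below and `1 + 1/k` above, for every `k` and all
-- large `n`, with denominators cleared.
theorem1p7 : (k : ℕ) → 1 ≤ k →
    Σ ℕ (λ N → (n : ℕ) → N ≤ n →
    ((k ∸ 1) * n ≤ 2 * k * gECB n) × (3 * k * gECB n ≤ 2 * (k + 1) * n))
-- The 9 is the threshold of both bounds; `14 * k ≤ n` absorbs the additive 14 of the lower bound,
-- and `k ≤ n` the 2 of the upper one.
theorem1p7 (suc j) _ = 9 + 14 * suc j , λ n N≤n →
  lower n (gECB n) (≤-trans (m≤n+m _ 9) N≤n) (gECB-lower (≤-trans (m≤m+n 9 _) N≤n)) ,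
  upper n (gECB n) (≤-trans (≤-trans (m≤n*m (suc j) 14) (m≤n+m _ 9)) N≤n) (gECB-upper (≤-trans (m≤m+n 9 _) N≤n))
  where
  open ≤-Reasoning
  lower : ∀ n g → 14 * suc j ≤ n → n ≤ 14 + 2 * g → j * n ≤ 2 * suc j * g
  lower n g 14k≤n n≤ = +-cancelˡ-≤ n _ _ (begin
    suc j * n                       ≤⟨ *-monoʳ-≤ (suc j) n≤ ⟩
    suc j * (14 + 2 * g)            ≡⟨ expand (suc j) g ⟩
    14 * suc j + 2 * suc j * g      ≤⟨ +-monoˡ-≤ _ 14k≤n ⟩
    n + 2 * suc j * g               ∎)
    where
    expand : ∀ k g → k * (14 + 2 * g) ≡ 14 * k + 2 * k * g
    expand = solve-∀
  upper : ∀ n g → suc j ≤ n → 3 * g ≤ 2 * n + 2 → 3 * suc j * g ≤ 2 * (suc j + 1) * n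
  upper n g k≤n g≤ = begin
    3 * suc j * g                   ≡⟨ commute (suc j) g ⟩
    suc j * (3 * g)                 ≤⟨ *-monoʳ-≤ (suc j) g≤ ⟩
    suc j * (2 * n + 2)             ≡⟨ expand (suc j) n ⟩
    2 * suc j * n + 2 * suc j       ≤⟨ +-monoʳ-≤ (2 * suc j * n) (*-monoʳ-≤ 2 k≤n) ⟩
    2 * suc j * n + 2 * n           ≡⟨ collect (suc j) n ⟩
    2 * (suc j + 1) * n             ∎
    where
    commute : ∀ k g → 3 * k * g ≡ k * (3 * g)
    commute = solve-∀
    expand : ∀ k n → k * (2 * n + 2) ≡ 2 * k * n + 2 * k
    expand = solve-∀
    collect : ∀ k n → 2 * k * n + 2 * n ≡ 2 * (k + 1) * n
    collect = solve-∀
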